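{- Let $n\ge 1$ and let $x=(x_1,\dots,x_n)\in\mathbb{R}^n$ with $x_i>0$ for all $i$. Let $V_n(x)$ be the $n$-dimensional volume of the polytope $$\Pi_n(x)=\{y\in\mathbb{R}^n: y_i\ge 0 \text{ and } y_1+\cdots+y_i\le x_1+\cdots+x_i \text{ for all } 1\le i\le n\}.$$ Then $$V_n(x)=\sum_{k\in K_n}\ \prod_{i=1}^n \frac{x_i^{k_i}}{k_i!}=\frac{1}{n!}\sum_{k\in K_n}\binom{n}{k_1,\dots,k_n}x_1^{k_1}\cdots x_n^{k_n},$$ where $$K_n=\Big\{k=(k_1,\dots,k_n)\in\mathbb{N}^n:\ \sum_{i=1}^j k_i\ge j \text{ for all } 1\le j\le n-1,\ \text{ and } \sum_{i=1}^n k_i=n\Big\}.$$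
   Context: $\mathbb{N}=\{0,1,2,\dots\}$. -}

module Defs where

open import Data.Integer.Base as ℤ using (+_)
open import Data.List.Base as List using (List; []; _∷_)
open import Data.List.Membership.Propositional using (_∈_)
open import Data.List.Membership.Propositional.Properties
  using (∈-cartesianProductWith⁺; ∈-filter⁺; ∈-filter⁻; ∈-upTo⁺)
open import Data.List.Relation.Unary.All as All using (All)
open import Data.List.Relation.Unary.AllPairs using (AllPairs)
open import Data.List.Relation.Unary.Any using (Any; here)
open import Data.List.Relation.Unary.Unique.Propositional using (Unique)
import Data.List.Relation.Unary.Unique.Propositional.Properties as Unique
open import Data.Nat.Base as ℕ using (ℕ; zero; suc; _!)
open import Data.Nat.Combinatorics using (k![n∸k]!∣n!)
open import Data.Nat.Divisibility using (_∣_; ∣-trans; *-monoʳ-∣; ∣-refl)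
import Data.Nat.ListAction as ListAction
import Data.Nat.Properties as ℕ
open import Data.Product.Base using (Σ; ∃; _×_; _,_; proj₁; proj₂)
open import Data.Rational.Base as ℚ using (ℚ; 0ℚ; 1ℚ; ½)
import Data.Rational.Properties as ℚ
open import Data.Rational.Solver using (module +-*-Solver)
open import Data.Vec.Base as Vec using (Vec; []; _∷_; lookup; toList)
open import Data.Vec.Properties using (∷-injective)
open import Function.Bundles using (_⇔_; mk⇔)
open import Relation.Binary.PropositionalEquality
  using (_≡_; refl; sym; trans; cong; cong₂; subst)
open import Relation.Nullary using (¬_; Dec)
open import Relation.Nullary.Decidable as Dec using (_×-dec_; _→-dec_)

------------------------------------------------------------------------
-- Real numbers: Cauchy sequences of rationals with a modulus, taken up to
-- _≃_.  Arithmetic is pointwise.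

IsCauchy : (ℕ → ℚ) → Set
IsCauchy s = ∀ ε → 0ℚ ℚ.< ε →
  ∃ λ N → ∀ m n → N ℕ.≤ m → N ℕ.≤ n → ℚ.∣ s m ℚ.- s n ∣ ℚ.< ε

record ℝ : Set where
  constructor mkℝ
  field
    seq    : ℕ → ℚ
    cauchy : IsCauchy seq

open ℝ public

infix 4 _≃_ _≤_ _<_

_≃_ : ℝ → ℝ → Set
x ≃ y = ∀ ε → 0ℚ ℚ.< ε →
  ∃ λ N → ∀ n → N ℕ.≤ n → ℚ.∣ seq x n ℚ.- seq y n ∣ ℚ.< ε

_≤_ : ℝ → ℝ → Set
x ≤ y = ∀ ε → 0ℚ ℚ.< ε →
  ∃ λ N → ∀ n → N ℕ.≤ n → seq x n ℚ.≤ seq y n ℚ.+ ε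

_<_ : ℝ → ℝ → Set
x < y = ∃ λ ε → 0ℚ ℚ.< ε ×
  (∃ λ N → ∀ n → N ℕ.≤ n → seq x n ℚ.+ ε ℚ.≤ seq y n)

private
  0<½* : ∀ {ε} → 0ℚ ℚ.< ε → 0ℚ ℚ.< ½ ℚ.* ε
  0<½* {ε} ε>0 = subst (ℚ._< ½ ℚ.* ε) (ℚ.*-zeroʳ ½) (ℚ.*-monoʳ-<-pos ½ ε>0)

  ½+½ : ∀ ε → ½ ℚ.* ε ℚ.+ ½ ℚ.* ε ≡ ε
  ½+½ ε = trans (sym (ℚ.*-distribʳ-+ ε ½ ½)) (ℚ.*-identityˡ ε)

const-cauchy : ∀ q → IsCauchy (λ _ → q)
const-cauchy q ε ε>0 = 0 , λ _ _ _ _ →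
  subst (λ r → ℚ.∣ r ∣ ℚ.< ε) (sym (ℚ.+-inverseʳ q)) ε>0

+-cauchy : ∀ s t → IsCauchy s → IsCauchy t → IsCauchy (λ n → s n ℚ.+ t n)
+-cauchy s t cs ct ε ε>0 with cs (½ ℚ.* ε) (0<½* ε>0) | ct (½ ℚ.* ε) (0<½* ε>0)
... | M , hs | N , ht = M ℕ.⊔ N , λ m n m≥ n≥ → begin-strict
  ℚ.∣ (s m ℚ.+ t m) ℚ.- (s n ℚ.+ t n) ∣
    ≡⟨ cong ℚ.∣_∣ (regroup (s m) (t m) (s n) (t n)) ⟩
  ℚ.∣ (s m ℚ.- s n) ℚ.+ (t m ℚ.- t n) ∣
    ≤⟨ ℚ.∣p+q∣≤∣p∣+∣q∣ (s m ℚ.- s n) (t m ℚ.- t n) ⟩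
  ℚ.∣ s m ℚ.- s n ∣ ℚ.+ ℚ.∣ t m ℚ.- t n ∣
    <⟨ ℚ.+-mono-< (hs m n (ℕ.m⊔n≤o⇒m≤o M N m≥) (ℕ.m⊔n≤o⇒m≤o M N n≥))
                  (ht m n (ℕ.m⊔n≤o⇒n≤o M N m≥) (ℕ.m⊔n≤o⇒n≤o M N n≥)) ⟩
  ½ ℚ.* ε ℚ.+ ½ ℚ.* ε
    ≡⟨ ½+½ ε ⟩
  ε ∎
  where
  open ℚ.≤-Reasoning
  open +-*-Solver
  regroup : ∀ a b c d → (a ℚ.+ b) ℚ.- (c ℚ.+ d) ≡ (a ℚ.- c) ℚ.+ (b ℚ.- d)
  regroup = solve 4 (λ a b c d → (a :+ b) :- (c :+ d) := (a :- c) :+ (b :- d)) refl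

neg-cauchy : ∀ s → IsCauchy s → IsCauchy (λ n → ℚ.- s n)
neg-cauchy s cs ε ε>0 with cs ε ε>0
... | N , h = N , λ m n m≥ n≥ →
  subst (ℚ._< ε)
    (trans (sym (ℚ.∣-p∣≡∣p∣ (s m ℚ.- s n)))
           (cong ℚ.∣_∣ (ℚ.neg-distrib-+ (s m) (ℚ.- s n))))
    (h m n m≥ n≥)

cauchy-bounded : ∀ s → IsCauchy s →
  ∃ λ B → 0ℚ ℚ.< B × (∃ λ N → ∀ n → N ℕ.≤ n → ℚ.∣ s n ∣ ℚ.≤ B)
cauchy-bounded s cs with cs 1ℚ (ℚ.positive⁻¹ 1ℚ)
... | N , h = 1ℚ ℚ.+ ℚ.∣ s N ∣
            , ℚ.+-mono-<-≤ (ℚ.positive⁻¹ 1ℚ) (ℚ.0≤∣p∣ (s N))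
            , N , λ n n≥ → begin
  ℚ.∣ s n ∣
    ≡⟨ cong ℚ.∣_∣ (split (s n) (s N)) ⟩
  ℚ.∣ (s n ℚ.- s N) ℚ.+ s N ∣
    ≤⟨ ℚ.∣p+q∣≤∣p∣+∣q∣ (s n ℚ.- s N) (s N) ⟩
  ℚ.∣ s n ℚ.- s N ∣ ℚ.+ ℚ.∣ s N ∣
    ≤⟨ ℚ.+-monoˡ-≤ ℚ.∣ s N ∣ (ℚ.<⇒≤ (h n N n≥ ℕ.≤-refl)) ⟩
  1ℚ ℚ.+ ℚ.∣ s N ∣ ∎
  where
  open ℚ.≤-Reasoning
  open +-*-Solver
  split : ∀ a b → a ≡ (a ℚ.- b) ℚ.+ b
  split = solve 2 (λ a b → a := (a :- b) :+ b) refl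

private
  scale : ∀ B → 0ℚ ℚ.< B → ∀ ε → 0ℚ ℚ.< ε →
    ∃ λ δ → 0ℚ ℚ.< δ × B ℚ.* δ ≡ ε
  scale B B>0 ε ε>0 = ℚ.1/ B ℚ.* ε , pos , eq
    where
    instance
      B⁺ : ℚ.Positive B
      B⁺ = ℚ.positive B>0
      B≢0 : ℚ.NonZero B
      B≢0 = ℚ.pos⇒nonZero B
      1/B⁺ : ℚ.Positive (ℚ.1/ B)
      1/B⁺ = ℚ.1/pos⇒pos B
    pos : 0ℚ ℚ.< ℚ.1/ B ℚ.* ε
    pos = subst (ℚ._< ℚ.1/ B ℚ.* ε) (ℚ.*-zeroʳ (ℚ.1/ B))
            (ℚ.*-monoʳ-<-pos (ℚ.1/ B) ε>0)
    eq : B ℚ.* (ℚ.1/ B ℚ.* ε) ≡ ε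
    eq = trans (sym (ℚ.*-assoc B (ℚ.1/ B) ε))
           (trans (cong (ℚ._* ε) (ℚ.*-inverseʳ B)) (ℚ.*-identityˡ ε))

  ∣*∣-bound : ∀ {B δ ε} → 0ℚ ℚ.< B → B ℚ.* δ ≡ ε →
    ∀ p q → ℚ.∣ p ∣ ℚ.≤ B → ℚ.∣ q ∣ ℚ.< δ → ℚ.∣ p ℚ.* q ∣ ℚ.< ε
  ∣*∣-bound {B} {δ} {ε} B>0 eq p q p≤ q< = begin-strict
    ℚ.∣ p ℚ.* q ∣
      ≡⟨ ℚ.∣p*q∣≡∣p∣*∣q∣ p q ⟩
    ℚ.∣ p ∣ ℚ.* ℚ.∣ q ∣
      ≤⟨ ℚ.*-monoʳ-≤-nonNeg ℚ.∣ q ∣ {{ℚ.∣-∣-nonNeg q}} p≤ ⟩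
    B ℚ.* ℚ.∣ q ∣
      <⟨ ℚ.*-monoʳ-<-pos B {{ℚ.positive B>0}} q< ⟩
    B ℚ.* δ
      ≡⟨ eq ⟩
    ε ∎
    where open ℚ.≤-Reasoning

private
  telescope : ∀ p q r → p ℚ.- r ≡ (p ℚ.- q) ℚ.+ (q ℚ.- r)
  telescope = solve 3 (λ p q r → p :- r := (p :- q) :+ (q :- r)) refl
    where open +-*-Solver

  *-distribˡ-- : ∀ p q r → p ℚ.* (q ℚ.- r) ≡ p ℚ.* q ℚ.- p ℚ.* r
  *-distribˡ-- p q r = trans (ℚ.*-distribˡ-+ p q (ℚ.- r))
    (cong (p ℚ.* q ℚ.+_) (sym (ℚ.neg-distribʳ-* p r)))

  *-difference : ∀ a b c d →
    a ℚ.* b ℚ.- c ℚ.* d ≡ a ℚ.* (b ℚ.- d) ℚ.+ d ℚ.* (a ℚ.- c)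
  *-difference a b c d = trans (telescope (a ℚ.* b) (a ℚ.* d) (c ℚ.* d))
    (cong₂ ℚ._+_ (sym (*-distribˡ-- a b d))
      (trans (cong₂ ℚ._-_ (ℚ.*-comm a d) (ℚ.*-comm c d)) (sym (*-distribˡ-- d a c))))

  *-difference-bound : ∀ ε a b c d →
    ℚ.∣ a ℚ.* (b ℚ.- d) ∣ ℚ.< ½ ℚ.* ε → ℚ.∣ d ℚ.* (a ℚ.- c) ∣ ℚ.< ½ ℚ.* ε →
    ℚ.∣ a ℚ.* b ℚ.- c ℚ.* d ∣ ℚ.< ε
  *-difference-bound ε a b c d h h′ = begin-strict
    ℚ.∣ a ℚ.* b ℚ.- c ℚ.* d ∣
      ≡⟨ cong ℚ.∣_∣ (*-difference a b c d) ⟩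
    ℚ.∣ a ℚ.* (b ℚ.- d) ℚ.+ d ℚ.* (a ℚ.- c) ∣
      ≤⟨ ℚ.∣p+q∣≤∣p∣+∣q∣ (a ℚ.* (b ℚ.- d)) (d ℚ.* (a ℚ.- c)) ⟩
    ℚ.∣ a ℚ.* (b ℚ.- d) ∣ ℚ.+ ℚ.∣ d ℚ.* (a ℚ.- c) ∣
      <⟨ ℚ.+-mono-< h h′ ⟩
    ½ ℚ.* ε ℚ.+ ½ ℚ.* ε
      ≡⟨ ½+½ ε ⟩
    ε ∎
    where open ℚ.≤-Reasoning

*-cauchy : ∀ s t → IsCauchy s → IsCauchy t → IsCauchy (λ n → s n ℚ.* t n)
*-cauchy s t cs ct ε ε>0 =
  let A , A>0 , K , hA = cauchy-bounded s cs
      B , B>0 , L , hB = cauchy-bounded t ct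
      α , α>0 , Aα = scale A A>0 (½ ℚ.* ε) (0<½* ε>0)
      β , β>0 , Bβ = scale B B>0 (½ ℚ.* ε) (0<½* ε>0)
      M , ht = ct α α>0
      N , hs = cs β β>0
  in (K ℕ.⊔ L) ℕ.⊔ (M ℕ.⊔ N) , λ m n m≥ n≥ →
    let m≥KL = ℕ.m⊔n≤o⇒m≤o (K ℕ.⊔ L) (M ℕ.⊔ N) m≥
        n≥KL = ℕ.m⊔n≤o⇒m≤o (K ℕ.⊔ L) (M ℕ.⊔ N) n≥
        m≥MN = ℕ.m⊔n≤o⇒n≤o (K ℕ.⊔ L) (M ℕ.⊔ N) m≥
        n≥MN = ℕ.m⊔n≤o⇒n≤o (K ℕ.⊔ L) (M ℕ.⊔ N) n≥
    in *-difference-bound ε (s m) (t m) (s n) (t n)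
         (∣*∣-bound A>0 Aα (s m) (t m ℚ.- t n) (hA m (ℕ.m⊔n≤o⇒m≤o K L m≥KL))
           (ht m n (ℕ.m⊔n≤o⇒m≤o M N m≥MN) (ℕ.m⊔n≤o⇒m≤o M N n≥MN)))
         (∣*∣-bound B>0 Bβ (t n) (s m ℚ.- s n) (hB n (ℕ.m⊔n≤o⇒n≤o K L n≥KL))
           (hs m n (ℕ.m⊔n≤o⇒n≤o M N m≥MN) (ℕ.m⊔n≤o⇒n≤o M N n≥MN)))

infixl 6 _+_ _-_
infixl 7 _*_
infixr 8 _^_

fromℚ : ℚ → ℝ
fromℚ q = mkℝ (λ _ → q) (const-cauchy q)

fromℕ : ℕ → ℝ
fromℕ m = fromℚ (+ m ℚ./ 1)

0ℝ 1ℝ : ℝ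
0ℝ = fromℚ 0ℚ
1ℝ = fromℚ 1ℚ

_+_ _-_ _*_ : ℝ → ℝ → ℝ
x + y = mkℝ (λ n → seq x n ℚ.+ seq y n) (+-cauchy (seq x) (seq y) (cauchy x) (cauchy y))
x - y = mkℝ (λ n → seq x n ℚ.- seq y n)
  (+-cauchy (seq x) (λ n → ℚ.- seq y n) (cauchy x) (neg-cauchy (seq y) (cauchy y)))
x * y = mkℝ (λ n → seq x n ℚ.* seq y n) (*-cauchy (seq x) (seq y) (cauchy x) (cauchy y))

_^_ : ℝ → ℕ → ℝ
x ^ zero  = 1ℝ
x ^ suc m = x * x ^ m

1/_! : ℕ → ℝ
1/ m ! = fromℚ ((+ 1 ℚ./ m !) {{m ℕ.!≢0}})

sumℝ : List ℝ → ℝ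
sumℝ = List.foldr _+_ 0ℝ

∏ : ∀ {n} → Vec ℝ n → ℝ
∏ = Vec.foldr′ _*_ 1ℝ

------------------------------------------------------------------------
-- n-dimensional volume as Jordan content, which for polytopes agrees with
-- Lebesgue measure and, like it, determines V up to _≃_.

record Box (n : ℕ) : Set where
  field
    lower upper : Vec ℝ n
    lower≤upper : ∀ i → lookup lower i ≤ lookup upper i

open Box public

infix 4 _∈ᵇ_

_∈ᵇ_ : ∀ {n} → Vec ℝ n → Box n → Set
y ∈ᵇ b = ∀ i → lookup (lower b) i ≤ lookup y i × lookup y i < lookup (upper b) i

boxVolume : ∀ {n} → Box n → ℝ
boxVolume b = ∏ (Vec.zipWith _-_ (upper b) (lower b))

totalVolume : ∀ {n} → List (Box n) → ℝ
totalVolume bs = sumℝ (List.map boxVolume bs)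

Disjoint : ∀ {n} → Box n → Box n → Set
Disjoint b c = ∀ y → ¬ (y ∈ᵇ b × y ∈ᵇ c)

IsVolume : ∀ {n} → (Vec ℝ n → Set) → ℝ → Set
IsVolume {n} S V = ∀ ε → 0ℝ < ε →
  (Σ (List (Box n)) λ bs →
     AllPairs Disjoint bs × All (λ b → ∀ y → y ∈ᵇ b → S y) bs ×
     V ≤ totalVolume bs + ε) ×
  (Σ (List (Box n)) λ bs →
     (∀ y → S y → Any (y ∈ᵇ_) bs) ×
     totalVolume bs ≤ V + ε)

------------------------------------------------------------------------

Π : ∀ {n} → Vec ℝ n → Vec ℝ n → Set
Π {n} x y =
  (∀ i → 0ℝ ≤ lookup y i) ×
  (∀ i → 1 ℕ.≤ i → i ℕ.≤ n →
     sumℝ (List.take i (toList y)) ≤ sumℝ (List.take i (toList x)))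

InK : ∀ {n} → Vec ℕ n → Set
InK {n} k =
  (∀ j → 1 ℕ.≤ j → j ℕ.≤ n ℕ.∸ 1 → j ℕ.≤ ListAction.sum (List.take j (toList k))) ×
  Vec.sum k ≡ n

inK? : ∀ {n} (k : Vec ℕ n) → Dec (InK k)
inK? {n} k =
  Dec.map′ (λ f j j≥1 j≤ → f (ℕ.s≤s j≤) j≥1) (λ f {j} j< j≥1 → f j j≥1 (ℕ.≤-pred j<))
    (ℕ.allUpTo? (λ j → (1 ℕ.≤? j) →-dec (j ℕ.≤? ListAction.sum (List.take j (toList k))))
                (suc (n ℕ.∸ 1)))
  ×-dec (Vec.sum k ℕ.≟ n)

boundedVecs : ℕ → (n : ℕ) → List (Vec ℕ n)
boundedVecs b zero    = [] ∷ []
boundedVecs b (suc n) =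
  List.cartesianProductWith _∷_ (List.upTo (suc b)) (boundedVecs b n)

-- The entries of a member of K n sum to n, so each is at most n.
K : (n : ℕ) → List (Vec ℕ n)
K n = List.filter inK? (boundedVecs n n)

∈-boundedVecs : ∀ {b n} (k : Vec ℕ n) → Vec.sum k ℕ.≤ b → k ∈ boundedVecs b n
∈-boundedVecs []      _ = here refl
∈-boundedVecs (a ∷ k) h = ∈-cartesianProductWith⁺ _∷_
  (∈-upTo⁺ (ℕ.s≤s (ℕ.≤-trans (ℕ.m≤m+n a (Vec.sum k)) h)))
  (∈-boundedVecs k (ℕ.≤-trans (ℕ.m≤n+m (Vec.sum k) a) h))

∈K⇔InK : ∀ {n} (k : Vec ℕ n) → (k ∈ K n) ⇔ InK k
∈K⇔InK {n} k = mk⇔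
  (λ k∈ → proj₂ (∈-filter⁻ inK? {xs = boundedVecs n n} k∈))
  (λ p → ∈-filter⁺ inK? (∈-boundedVecs k (ℕ.≤-reflexive (proj₂ p))) p)

boundedVecs-unique : ∀ b n → Unique (boundedVecs b n)
boundedVecs-unique b zero    = All.[] AllPairs.∷ AllPairs.[]
  where open import Data.List.Relation.Unary.AllPairs as AllPairs
boundedVecs-unique b (suc n) =
  Unique.cartesianProductWith⁺ _∷_ ∷-injective
    (Unique.upTo⁺ (suc b)) (boundedVecs-unique b n)

K-unique : ∀ n → Unique (K n)
K-unique n = Unique.filter⁺ inK? (boundedVecs-unique n n)

∏! : ∀ {m} → Vec ℕ m → ℕ
∏! k = Vec.foldr′ ℕ._*_ 1 (Vec.map _! k)

∏!≢0 : ∀ {m} (k : Vec ℕ m) → ℕ.NonZero (∏! k)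
∏!≢0 []      = _
∏!≢0 (a ∷ k) = ℕ.m*n≢0 (a !) (∏! k) {{a ℕ.!≢0}} {{∏!≢0 k}}

-- The division is exact when the entries of k sum to n.
multinomial : ∀ {m} → ℕ → Vec ℕ m → ℕ
multinomial n k = (n ! ℕ./ ∏! k) {{∏!≢0 k}}

∏!∣sum! : ∀ {m} (k : Vec ℕ m) → ∏! k ∣ Vec.sum k !
∏!∣sum! []      = ∣-refl
∏!∣sum! (a ∷ k) = ∣-trans (*-monoʳ-∣ (a !) (∏!∣sum! k))
  (subst (λ j → a ! ℕ.* j ! ∣ (a ℕ.+ Vec.sum k) !) (ℕ.m+n∸m≡n a (Vec.sum k))
    (k![n∸k]!∣n! (ℕ.m≤m+n a (Vec.sum k))))

{-# OPTIONS --safe #-}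

-- Slicing Π by its first coordinate turns the volume into an iterated integral of polynomials,
-- which in the basis of divided powers t ^ k / k ! is a shift of coefficients; unfolding the
-- shifts yields the sum over K.  The integrand f = F′ has nonnegative coefficients, so
-- h f(u) ≤ F(u + h) − F(u) ≤ h f(u + h), and Riemann sums telescope to within h f(r) of the
-- integral over [0 , r].  Boxes built this way have rational corners, so all geometry is decidable;
-- real x is squeezed between rational vectors and real points are rounded to rational ones.

module Submission where

import Data.Integer.Base as ℤ
import Data.Integer.Properties as ℤ
import Data.List.Properties as List
import Data.List.Relation.Unary.All.Properties as All
import Data.List.Relation.Unary.AllPairs.Properties as AllPairs
import Data.List.Relation.Unary.Any.Properties as Any
import Data.Nat.ListAction as ListAction
import Data.Nat.Properties as ℕ
import Data.Rational.Properties as ℚ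
import Data.Rational.Unnormalised.Base as ℚᵘ
import Data.Rational.Unnormalised.Properties as ℚᵘ
import Data.Vec.Relation.Unary.All as VecAll
import Data.Vec.Relation.Unary.All.Properties as VecAll
import Defs as R

-- A section of Π at a fixed first coordinate is a polytope of the same kind only if all later
-- partial sums are allowed a common slack s. The induction therefore runs over the family in s, and
-- the volume is carried as a polynomial in s rather than as a number. This is also where the ballot
-- condition comes from. Coefficient e of the polynomial is the sum over the exponent vectors that
-- succeed with e units in advance: translation by x earns a units at the price x ^ a / a !, and the
-- zero prefixed by an integration spends one unit. The sum over K is the case e = 0. The outer
-- cover is the delicate half. A real point must be assigned to one of finitely many boxes although
-- comparison of reals is undecidable. Rounding the point makes the comparisons decidable; its cost
-- is paid by enlarging both x and the boxes, and the enlargements must be small against constants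
-- fixed beforehand.

module RationalApproximation where

  open import Data.Bool.Base using (Bool; true; false; T; if_then_else_)
  open import Data.Empty using (⊥)
  open import Data.Fin.Base as Fin using ()
  open import Data.List.Base as List using (List; []; _∷_; _++_)
  open import Data.List.Relation.Unary.All as All using (All; []; _∷_)
  open import Data.List.Relation.Unary.AllPairs as AllPairs using (AllPairs; []; _∷_)
  open import Data.List.Relation.Unary.Any as Any using (Any; here)
  open import Data.Nat.Base as ℕ using (ℕ; zero; suc; _!; z≤n; s≤s)
  open import Data.Nat.DivMod using (m/n*n≡m)
  open import Data.Product.Base using (Σ; ∃; _×_; _,_; proj₁; proj₂)
  open import Data.Rational.Base as ℚ using (ℚ; 0ℚ; 1ℚ; ½; _+_; _*_; _-_; -_; _≤_; _<_)
  open import Data.Rational.Solver using (module +-*-Solver)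
  open import Data.Sum.Base using (_⊎_; inj₁; inj₂)
  open import Data.Unit.Base using (⊤; tt)
  open import Data.Vec.Base as Vec using (Vec; []; _∷_; toList; lookup)
  open import Data.Vec.Relation.Binary.Pointwise.Inductive using (Pointwise; []; _∷_)
  open import Function.Base using (_∘_)
  open import Function.Bundles using (_⇔_; mk⇔; Equivalence)
  open import Relation.Binary.PropositionalEquality
    using (_≡_; refl; sym; trans; cong; cong₂; subst; subst₂; module ≡-Reasoning)
  open import Relation.Nullary using (yes; no)
  open import Relation.Nullary.Decidable using (does; does-⇔; T?)
  open import Relation.Unary using (Decidable)
  open import Defs using
    ( ℝ; seq; cauchy; cauchy-bounded; fromℚ; 0ℝ; Box; lower; upper; Π; IsVolume
    ; K; boundedVecs; InK; inK?; ∈K⇔InK; multinomial; ∏!; ∏!≢0; ∏!∣sum! )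
  open +-*-Solver using (solve; con; _:=_; _:+_; _:*_; _:-_)

  -- Order lemmas for the rationals

  -- Reduces an inequality to a ring identity for the solver, with the nonnegative difference
  -- supplied by hand.
  ≤-by : ∀ {p q} r → 0ℚ ≤ r → q ≡ p + r → p ≤ q
  ≤-by {p} r 0≤r refl = subst (_≤ p + r) (ℚ.+-identityʳ p) (ℚ.+-monoʳ-≤ p 0≤r)

  0≤-difference : ∀ {p q} → p ≤ q → 0ℚ ≤ q - p
  0≤-difference {p} {q} p≤q = subst (_≤ q - p) (ℚ.+-inverseʳ p) (ℚ.+-monoˡ-≤ (- p) p≤q)

  0≤+ : ∀ {p q} → 0ℚ ≤ p → 0ℚ ≤ q → 0ℚ ≤ p + q
  0≤+ = ℚ.+-mono-≤

  0<+ : ∀ {p q} → 0ℚ < p → 0ℚ ≤ q → 0ℚ < p + q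
  0<+ = ℚ.+-mono-<-≤

  *-monoˡ-≤ : ∀ {p q r} → 0ℚ ≤ r → p ≤ q → r * p ≤ r * q
  *-monoˡ-≤ {r = r} 0≤r = ℚ.*-monoˡ-≤-nonNeg r {{ℚ.nonNegative 0≤r}}

  *-monoʳ-≤ : ∀ {p q r} → 0ℚ ≤ r → p ≤ q → p * r ≤ q * r
  *-monoʳ-≤ {r = r} 0≤r = ℚ.*-monoʳ-≤-nonNeg r {{ℚ.nonNegative 0≤r}}

  *-mono-≤ : ∀ {p q r s} → 0ℚ ≤ p → 0ℚ ≤ r → p ≤ q → r ≤ s → p * r ≤ q * s
  *-mono-≤ 0≤p 0≤r p≤q r≤s =
    ℚ.≤-trans (*-monoʳ-≤ 0≤r p≤q) (*-monoˡ-≤ (ℚ.≤-trans 0≤p p≤q) r≤s)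

  0≤* : ∀ {p q} → 0ℚ ≤ p → 0ℚ ≤ q → 0ℚ ≤ p * q
  0≤* {p} 0≤p 0≤q = subst (_≤ p * _) (ℚ.*-zeroʳ p) (*-monoˡ-≤ 0≤p 0≤q)

  0<* : ∀ {p q} → 0ℚ < p → 0ℚ < q → 0ℚ < p * q
  0<* {p} 0<p 0<q =
    subst (_< p * _) (ℚ.*-zeroʳ p) (ℚ.*-monoʳ-<-pos p {{ℚ.positive 0<p}} 0<q)

  0<1 : 0ℚ < 1ℚ
  0<1 = ℚ.positive⁻¹ 1ℚ

  0≤1 : 0ℚ ≤ 1ℚ
  0≤1 = ℚ.<⇒≤ 0<1

  -- Natural numbers and reciprocal factorials in the rationals

  fromℕℚ : ℕ → ℚ
  fromℕℚ n = ℤ.+ n ℚ./ 1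

  private
    toℚᵘ-fromℕℚ : ∀ n → ℚ.toℚᵘ (fromℕℚ n) ℚᵘ.≃ ℚᵘ.mkℚᵘ (ℤ.+ n) 0
    toℚᵘ-fromℕℚ n = ℚ.toℚᵘ-fromℚᵘ (ℚᵘ.mkℚᵘ (ℤ.+ n) 0)

  fromℕℚ-+ : ∀ m n → fromℕℚ (m ℕ.+ n) ≡ fromℕℚ m + fromℕℚ n
  fromℕℚ-+ m n = ℚ.toℚᵘ-injective (begin
    ℚ.toℚᵘ (fromℕℚ (m ℕ.+ n))                     ≈⟨ toℚᵘ-fromℕℚ (m ℕ.+ n) ⟩
    ℚᵘ.mkℚᵘ (ℤ.+ (m ℕ.+ n)) 0                       ≈⟨ ℚᵘ.*≡* (cong (ℤ._* ℤ.+ 1) (sym eq)) ⟩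
    ℚᵘ.mkℚᵘ (ℤ.+ m) 0 ℚᵘ.+ ℚᵘ.mkℚᵘ (ℤ.+ n) 0          ≈⟨ ℚᵘ.+-cong (toℚᵘ-fromℕℚ m) (toℚᵘ-fromℕℚ n) ⟨
    ℚ.toℚᵘ (fromℕℚ m) ℚᵘ.+ ℚ.toℚᵘ (fromℕℚ n)      ≈⟨ ℚ.toℚᵘ-homo-+ (fromℕℚ m) (fromℕℚ n) ⟨
    ℚ.toℚᵘ (fromℕℚ m + fromℕℚ n)                  ∎)
    where
    open ℚᵘ.≃-Reasoning
    eq : ℤ.+ m ℤ.* ℤ.+ 1 ℤ.+ ℤ.+ n ℤ.* ℤ.+ 1 ≡ ℤ.+ (m ℕ.+ n)
    eq = cong₂ ℤ._+_ (ℤ.*-identityʳ (ℤ.+ m)) (ℤ.*-identityʳ (ℤ.+ n))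

  fromℕℚ-* : ∀ m n → fromℕℚ (m ℕ.* n) ≡ fromℕℚ m * fromℕℚ n
  fromℕℚ-* m n = ℚ.toℚᵘ-injective (begin
    ℚ.toℚᵘ (fromℕℚ (m ℕ.* n))                     ≈⟨ toℚᵘ-fromℕℚ (m ℕ.* n) ⟩
    ℚᵘ.mkℚᵘ (ℤ.+ (m ℕ.* n)) 0                       ≈⟨ ℚᵘ.*≡* (cong (ℤ._* ℤ.+ 1) (ℤ.pos-* m n)) ⟩
    ℚᵘ.mkℚᵘ (ℤ.+ m) 0 ℚᵘ.* ℚᵘ.mkℚᵘ (ℤ.+ n) 0          ≈⟨ ℚᵘ.*-cong (toℚᵘ-fromℕℚ m) (toℚᵘ-fromℕℚ n) ⟨
    ℚ.toℚᵘ (fromℕℚ m) ℚᵘ.* ℚ.toℚᵘ (fromℕℚ n)      ≈⟨ ℚ.toℚᵘ-homo-* (fromℕℚ m) (fromℕℚ n) ⟨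
    ℚ.toℚᵘ (fromℕℚ m * fromℕℚ n)                  ∎)
    where open ℚᵘ.≃-Reasoning

  0<fromℕℚ-suc : ∀ n → 0ℚ < fromℕℚ (suc n)
  0<fromℕℚ-suc n = ℚ.positive⁻¹ (fromℕℚ (suc n)) {{ℚ.normalize-pos (suc n) 1}}

  1/n*n≡1 : ∀ n .{{_ : ℕ.NonZero n}} → (ℤ.+ 1 ℚ./ n) * fromℕℚ n ≡ 1ℚ
  1/n*n≡1 n@(suc m) = ℚ.toℚᵘ-injective (begin
    ℚ.toℚᵘ ((ℤ.+ 1 ℚ./ n) * fromℕℚ n)               ≈⟨ ℚ.toℚᵘ-homo-* (ℤ.+ 1 ℚ./ n) (fromℕℚ n) ⟩
    ℚ.toℚᵘ (ℤ.+ 1 ℚ./ n) ℚᵘ.* ℚ.toℚᵘ (fromℕℚ n)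
      ≈⟨ ℚᵘ.*-cong (ℚ.toℚᵘ-fromℚᵘ (ℚᵘ.mkℚᵘ (ℤ.+ 1) m)) (toℚᵘ-fromℕℚ n) ⟩
    ℚᵘ.mkℚᵘ (ℤ.+ 1) m ℚᵘ.* ℚᵘ.mkℚᵘ (ℤ.+ n) 0          ≈⟨ ℚᵘ.*≡* eq ⟩
    ℚᵘ.1ℚᵘ                                        ∎)
    where
    open ℚᵘ.≃-Reasoning
    eq : (ℤ.+ 1 ℤ.* ℤ.+ n) ℤ.* ℤ.+ 1 ≡ ℤ.+ 1 ℤ.* ℤ.+ (n ℕ.* 1)
    eq = trans (ℤ.*-identityʳ (ℤ.+ 1 ℤ.* ℤ.+ n)) (cong (λ z → ℤ.+ 1 ℤ.* ℤ.+ z) (sym (ℕ.*-identityʳ n)))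

  recip! : ℕ → ℚ
  recip! k = (ℤ.+ 1 ℚ./ k !) {{k ℕ.!≢0}}

  recip!*! : ∀ k → recip! k * fromℕℚ (k !) ≡ 1ℚ
  recip!*! k = 1/n*n≡1 (k !) {{k ℕ.!≢0}}

  0≤recip! : ∀ k → 0ℚ ≤ recip! k
  0≤recip! k = ℚ.nonNegative⁻¹ (recip! k) {{ℚ.normalize-nonNeg 1 (k !) {{k ℕ.!≢0}}}}

  -- The two reciprocals are separately normalised fractions, so they are compared through their
  -- defining equations: a factor 1 is inserted as `r * b`, and `a * b` is the factorial that
  -- cancels `r′`.
  recip!-suc : ∀ k → fromℕℚ (suc k) * recip! (suc k) ≡ recip! k
  recip!-suc k = begin
    a * r′                    ≡⟨ ℚ.*-identityʳ (a * r′) ⟨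
    a * r′ * 1ℚ               ≡⟨ cong (a * r′ *_) (recip!*! k) ⟨
    a * r′ * (r * b)          ≡⟨ solve 4 (λ a r′ r b → a :* r′ :* (r :* b) := r :* (r′ :* (a :* b))) refl a r′ r b ⟩
    r * (r′ * (a * b))        ≡⟨ cong (λ z → r * (r′ * z)) (fromℕℚ-* (suc k) (k !)) ⟨
    r * (r′ * fromℕℚ (suc k !)) ≡⟨ cong (r *_) (recip!*! (suc k)) ⟩
    r * 1ℚ                    ≡⟨ ℚ.*-identityʳ r ⟩
    r                         ∎
    where
    open ≡-Reasoning
    a = fromℕℚ (suc k)
    b = fromℕℚ (k !)
    r = recip! k
    r′ = recip! (suc k)

  fromℕℚ-suc : ∀ k → fromℕℚ (suc k) ≡ 1ℚ + fromℕℚ k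
  fromℕℚ-suc = fromℕℚ-+ 1

  -- Divided powers and their increments

  infixr 8 _^ℚ_

  _^ℚ_ : ℚ → ℕ → ℚ
  t ^ℚ zero  = 1ℚ
  t ^ℚ suc k = t * t ^ℚ k

  dpow : ℚ → ℕ → ℚ
  dpow t k = t ^ℚ k * recip! k

  -- A division-free recursion. Inductions on the exponent multiply by k + 1, apply it and cancel.
  dpow-suc : ∀ t k → fromℕℚ (suc k) * dpow t (suc k) ≡ t * dpow t k
  dpow-suc t k = begin
    a * (t * p * r′)     ≡⟨ solve 4 (λ a t p r′ → a :* (t :* p :* r′) := t :* (p :* (a :* r′))) refl a t p r′ ⟩
    t * (p * (a * r′))   ≡⟨ cong (λ z → t * (p * z)) (recip!-suc k) ⟩
    t * (p * recip! k)   ∎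
    where
    open ≡-Reasoning
    a = fromℕℚ (suc k)
    p = t ^ℚ k
    r′ = recip! (suc k)

  ^ℚ-mono-≤ : ∀ {s t} k → 0ℚ ≤ s → s ≤ t → s ^ℚ k ≤ t ^ℚ k
  0≤^ℚ : ∀ {t} k → 0ℚ ≤ t → 0ℚ ≤ t ^ℚ k
  ^ℚ-mono-≤ zero    0≤s s≤t = ℚ.≤-refl
  ^ℚ-mono-≤ (suc k) 0≤s s≤t = *-mono-≤ 0≤s (0≤^ℚ k 0≤s) s≤t (^ℚ-mono-≤ k 0≤s s≤t)
  0≤^ℚ zero    0≤t = 0≤1
  0≤^ℚ (suc k) 0≤t = 0≤* 0≤t (0≤^ℚ k 0≤t)

  dpow-mono-≤ : ∀ {s t} k → 0ℚ ≤ s → s ≤ t → dpow s k ≤ dpow t k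
  dpow-mono-≤ k 0≤s s≤t = *-monoʳ-≤ (0≤recip! k) (^ℚ-mono-≤ k 0≤s s≤t)

  0≤dpow : ∀ {t} k → 0ℚ ≤ t → 0ℚ ≤ dpow t k
  0≤dpow k 0≤t = 0≤* (0≤^ℚ k 0≤t) (0≤recip! k)

  *-cancelˡ-≤-suc : ∀ k {p q} → fromℕℚ (suc k) * p ≤ fromℕℚ (suc k) * q → p ≤ q
  *-cancelˡ-≤-suc k = ℚ.*-cancelˡ-≤-pos (fromℕℚ (suc k)) {{ℚ.positive (0<fromℕℚ-suc k)}}

  *-cancelˡ-suc : ∀ k {p q} → fromℕℚ (suc k) * p ≡ fromℕℚ (suc k) * q → p ≡ q
  *-cancelˡ-suc k e = ℚ.≤-antisym (*-cancelˡ-≤-suc k (ℚ.≤-reflexive e))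
                                  (*-cancelˡ-≤-suc k (ℚ.≤-reflexive (sym e)))

  module _ {u h : ℚ} (0≤u : 0ℚ ≤ u) (0≤h : 0ℚ ≤ h) where
    open ℚ.≤-Reasoning

    private
      0≤u+h : 0ℚ ≤ u + h
      0≤u+h = 0≤+ 0≤u 0≤h

      u≤u+h : u ≤ u + h
      u≤u+h = ≤-by h 0≤h refl

    -- A mean value inequality without derivatives. After multiplication by k + 1 the left side is
    -- `u * (D + h * dpow u j) + h * D`; the induction hypothesis bounds the bracket by `D′`,
    -- monotonicity bounds the last `D`, and `(u + h) * D′` is the recursion on the right.
    dpow-increment-≥ : ∀ k → dpow u (suc k) + h * dpow u k ≤ dpow (u + h) (suc k)
    dpow-increment-≥ zero = ℚ.≤-reflexive
      (solve 3 (λ u h r → u :* con 1ℚ :* r :+ h :* (con 1ℚ :* r) := (u :+ h) :* con 1ℚ :* r) refl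
        u h (recip! 0))
    dpow-increment-≥ k@(suc j) = *-cancelˡ-≤-suc k (begin
      κ * (dpow u (suc k) + h * D)           ≡⟨ solve 4 (λ κ a h D → κ :* (a :+ h :* D) := κ :* a :+ h :* (κ :* D)) refl κ (dpow u (suc k)) h D ⟩
      κ * dpow u (suc k) + h * (κ * D)       ≡⟨ cong₂ (λ a b → a + h * (b * D)) (dpow-suc u k) (fromℕℚ-suc k) ⟩
      u * D + h * ((1ℚ + J) * D)             ≡⟨ solve 4 (λ u D h J → u :* D :+ h :* ((con 1ℚ :+ J) :* D) := u :* D :+ h :* (J :* D) :+ h :* D) refl u D h J ⟩
      u * D + h * (J * D) + h * D            ≡⟨ cong (λ z → u * D + h * z + h * D) (dpow-suc u j) ⟩
      u * D + h * (u * dpow u j) + h * D     ≡⟨ solve 4 (λ u D h z → u :* D :+ h :* (u :* z) :+ h :* D := u :* (D :+ h :* z) :+ h :* D) refl u D h (dpow u j) ⟩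
      u * (D + h * dpow u j) + h * D         ≤⟨ ℚ.+-mono-≤ (*-monoˡ-≤ 0≤u (dpow-increment-≥ j)) (*-monoˡ-≤ 0≤h (dpow-mono-≤ k 0≤u u≤u+h)) ⟩
      u * D′ + h * D′                        ≡⟨ ℚ.*-distribʳ-+ D′ u h ⟨
      (u + h) * D′                           ≡⟨ dpow-suc (u + h) k ⟨
      κ * dpow (u + h) (suc k)               ∎)
      where
      κ = fromℕℚ (suc k)
      J = fromℕℚ k
      D = dpow u k
      D′ = dpow (u + h) k

    -- The same induction read from the other end. The extra move enlarges the factor u in front of
    -- `dpow (u + h) j` to u + h, so that the recursion turns the product into a multiple of `D′`.
    dpow-increment-≤ : ∀ k → dpow (u + h) (suc k) ≤ dpow u (suc k) + h * dpow (u + h) k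
    dpow-increment-≤ zero = ℚ.≤-reflexive
      (solve 3 (λ u h r → (u :+ h) :* con 1ℚ :* r := u :* con 1ℚ :* r :+ h :* (con 1ℚ :* r)) refl
        u h (recip! 0))
    dpow-increment-≤ k@(suc j) = *-cancelˡ-≤-suc k (begin
      κ * dpow (u + h) (suc k)               ≡⟨ dpow-suc (u + h) k ⟩
      (u + h) * D′                           ≡⟨ ℚ.*-distribʳ-+ D′ u h ⟩
      u * D′ + h * D′                        ≤⟨ ℚ.+-monoˡ-≤ (h * D′) (*-monoˡ-≤ 0≤u (dpow-increment-≤ j)) ⟩
      u * (D + h * dpow (u + h) j) + h * D′  ≡⟨ solve 5 (λ u D h z e → u :* (D :+ h :* z) :+ e := u :* D :+ (h :* (u :* z) :+ e)) refl u D h (dpow (u + h) j) (h * D′) ⟩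
      u * D + (h * (u * dpow (u + h) j) + h * D′)
        ≤⟨ ℚ.+-monoʳ-≤ (u * D) (ℚ.+-monoˡ-≤ (h * D′) (*-monoˡ-≤ 0≤h (*-monoʳ-≤ (0≤dpow j 0≤u+h) u≤u+h))) ⟩
      u * D + (h * ((u + h) * dpow (u + h) j) + h * D′)
        ≡⟨ cong (λ z → u * D + (h * z + h * D′)) (dpow-suc (u + h) j) ⟨
      u * D + (h * (J * D′) + h * D′)        ≡⟨ solve 4 (λ a D h J → a :+ (h :* (J :* D) :+ h :* D) := a :+ h :* ((con 1ℚ :+ J) :* D)) refl (u * D) D′ h J ⟩
      u * D + h * ((1ℚ + J) * D′)            ≡⟨ cong₂ (λ a b → a + h * (b * D′)) (dpow-suc u k) (fromℕℚ-suc k) ⟨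
      κ * dpow u (suc k) + h * (κ * D′)      ≡⟨ solve 4 (λ κ a h D → κ :* a :+ h :* (κ :* D) := κ :* (a :+ h :* D)) refl κ (dpow u (suc k)) h D′ ⟩
      κ * (dpow u (suc k) + h * D′)          ∎)
      where
      κ = fromℕℚ (suc k)
      J = fromℕℚ k
      D = dpow u k
      D′ = dpow (u + h) k

  -- Convolution of coefficient sequences

  infixl 7 _⋆_

  _⋆_ : (ℕ → ℚ) → (ℕ → ℚ) → ℕ → ℚ
  (w ⋆ v) zero    = w 0 * v 0
  (w ⋆ v) (suc k) = w 0 * v (suc k) + ((w ∘ suc) ⋆ v) k

  ⋆-cong : ∀ {w w′ v v′} → (∀ k → w k ≡ w′ k) → (∀ k → v k ≡ v′ k) → ∀ k → (w ⋆ v) k ≡ (w′ ⋆ v′) k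
  ⋆-cong e f zero    = cong₂ _*_ (e 0) (f 0)
  ⋆-cong e f (suc k) = cong₂ _+_ (cong₂ _*_ (e 0) (f (suc k))) (⋆-cong (e ∘ suc) f k)

  ⋆-distribʳ-+ : ∀ w w′ v k → ((λ i → w i + w′ i) ⋆ v) k ≡ (w ⋆ v) k + (w′ ⋆ v) k
  ⋆-distribʳ-+ w w′ v zero    = ℚ.*-distribʳ-+ (v 0) (w 0) (w′ 0)
  ⋆-distribʳ-+ w w′ v (suc k) =
    trans (cong ((w 0 + w′ 0) * v (suc k) +_) (⋆-distribʳ-+ (w ∘ suc) (w′ ∘ suc) v k))
      (solve 5 (λ a b c x y → (a :+ b) :* c :+ (x :+ y) := a :* c :+ x :+ (b :* c :+ y)) refl
        (w 0) (w′ 0) (v (suc k)) _ _)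

  ⋆-*ˡ : ∀ c w v k → ((λ i → c * w i) ⋆ v) k ≡ c * (w ⋆ v) k
  ⋆-*ˡ c w v zero    = ℚ.*-assoc c (w 0) (v 0)
  ⋆-*ˡ c w v (suc k) = trans (cong (c * w 0 * v (suc k) +_) (⋆-*ˡ c (w ∘ suc) v k))
    (solve 4 (λ c a b x → c :* a :* b :+ c :* x := c :* (a :* b :+ x)) refl c (w 0) (v (suc k)) _)

  ⋆-*ʳ : ∀ c w v k → (w ⋆ (λ i → c * v i)) k ≡ c * (w ⋆ v) k
  ⋆-*ʳ c w v zero    = solve 3 (λ c a b → a :* (c :* b) := c :* (a :* b)) refl c (w 0) (v 0)
  ⋆-*ʳ c w v (suc k) = trans (cong (w 0 * (c * v (suc k)) +_) (⋆-*ʳ c (w ∘ suc) v k))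
    (solve 4 (λ c a b x → a :* (c :* b) :+ c :* x := c :* (a :* b :+ x)) refl c (w 0) (v (suc k)) _)

  -- The recursion of `_⋆_` shifts its left argument; shifting the right one drops the summand with
  -- `v 0`, which must vanish.
  ⋆-shiftʳ : ∀ w v → v 0 ≡ 0ℚ → ∀ k → (w ⋆ v) (suc k) ≡ (w ⋆ (v ∘ suc)) k
  ⋆-shiftʳ w v v0≡0 zero    = trans (cong (λ z → w 0 * v 1 + w 1 * z) v0≡0)
    (solve 2 (λ a b → a :+ b :* con 0ℚ := a) refl (w 0 * v 1) (w 1))
  ⋆-shiftʳ w v v0≡0 (suc k) = cong (w 0 * v (suc (suc k)) +_) (⋆-shiftʳ (w ∘ suc) v v0≡0 k)

  -- The coefficients of t d/dt applied to a power series.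
  euler : (ℕ → ℚ) → ℕ → ℚ
  euler w k = fromℕℚ k * w k

  -- In a summand `w i * v (k - i)` the factor k splits as i + (k - i).
  euler-⋆ : ∀ w v k → euler (w ⋆ v) k ≡ (euler w ⋆ v) k + (w ⋆ euler v) k
  euler-⋆ w v zero    = solve 2 (λ a b → con 0ℚ :* (a :* b) := con 0ℚ :* a :* b :+ a :* (con 0ℚ :* b)) refl (w 0) (v 0)
  euler-⋆ w v (suc k) = begin
    κ * (w 0 * v (suc k) + C)              ≡⟨ solve 4 (λ κ a b C → κ :* (a :* b :+ C) := a :* (κ :* b) :+ κ :* C) refl κ (w 0) (v (suc k)) C ⟩
    A + κ * C                              ≡⟨ cong (λ z → A + z * C) (fromℕℚ-suc k) ⟩
    A + (1ℚ + fromℕℚ k) * C                ≡⟨ solve 3 (λ A k C → A :+ (con 1ℚ :+ k) :* C := A :+ (C :+ k :* C)) refl A (fromℕℚ k) C ⟩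
    A + (C + euler (w′ ⋆ v) k)             ≡⟨ cong (λ z → A + (C + z)) (euler-⋆ w′ v k) ⟩
    -- The zero summand is the leading term of `euler w ⋆ v`, and `C + (euler w′ ⋆ v) k` is its
    -- remainder: shifting w lowers each index by one, so `euler w′` misses one copy of `w′`.
    A + (C + ((euler w′ ⋆ v) k + E))       ≡⟨ solve 5 (λ A C x E c → A :+ (C :+ (x :+ E)) := (con 0ℚ :* c :+ (C :+ x)) :+ (A :+ E)) refl A C ((euler w′ ⋆ v) k) E (w 0 * v (suc k)) ⟩
    0ℚ * (w 0 * v (suc k)) + (C + (euler w′ ⋆ v) k) + (A + E)
      ≡⟨ cong₂ (λ y z → y + z + (A + E)) (sym (ℚ.*-assoc 0ℚ (w 0) (v (suc k))))
           (sym (trans (⋆-cong {v = v} step (λ _ → refl) k) (⋆-distribʳ-+ w′ (euler w′) v k))) ⟩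
    (euler w ⋆ v) (suc k) + (w ⋆ euler v) (suc k) ∎
    where
    open ≡-Reasoning
    w′ = w ∘ suc
    κ = fromℕℚ (suc k)
    C = (w′ ⋆ v) k
    A = w 0 * (κ * v (suc k))
    E = (w′ ⋆ euler v) k
    step : ∀ i → euler w (suc i) ≡ w′ i + euler w′ i
    step i = trans (cong (_* w′ i) (fromℕℚ-suc i))
      (solve 2 (λ i a → (con 1ℚ :+ i) :* a := a :+ i :* a) refl (fromℕℚ i) (w′ i))

  -- Both sides satisfy the recursion (k + 1) f (k + 1) = (s + t) f k; for the convolution this is
  -- the Leibniz rule for the Euler operator.
  dpow-⋆ : ∀ s t k → (dpow s ⋆ dpow t) k ≡ dpow (s + t) k
  dpow-⋆ s t zero    = refl
  dpow-⋆ s t (suc k) = *-cancelˡ-suc k (begin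
    euler (dpow s ⋆ dpow t) (suc k)
      ≡⟨ euler-⋆ (dpow s) (dpow t) (suc k) ⟩
    (euler (dpow s) ⋆ dpow t) (suc k) + (dpow s ⋆ euler (dpow t)) (suc k)
      ≡⟨ cong₂ _+_ left right ⟩
    s * (dpow s ⋆ dpow t) k + t * (dpow s ⋆ dpow t) k
      ≡⟨ ℚ.*-distribʳ-+ _ s t ⟨
    (s + t) * (dpow s ⋆ dpow t) k
      ≡⟨ cong ((s + t) *_) (dpow-⋆ s t k) ⟩
    (s + t) * dpow (s + t) k
      ≡⟨ dpow-suc (s + t) k ⟨
    fromℕℚ (suc k) * dpow (s + t) (suc k) ∎)
    where
    open ≡-Reasoning
    left : (euler (dpow s) ⋆ dpow t) (suc k) ≡ s * (dpow s ⋆ dpow t) k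
    left = trans (cong₂ _+_ (ℚ.*-zeroˡ (dpow t (suc k)))
                   (trans (⋆-cong {v = dpow t} (dpow-suc s) (λ _ → refl) k) (⋆-*ˡ s (dpow s) (dpow t) k)))
                 (ℚ.+-identityˡ _)
    right : (dpow s ⋆ euler (dpow t)) (suc k) ≡ t * (dpow s ⋆ dpow t) k
    right = trans (⋆-shiftʳ (dpow s) (euler (dpow t)) refl k)
              (trans (⋆-cong {w = dpow s} (λ _ → refl) (dpow-suc t) k) (⋆-*ʳ t (dpow s) (dpow t) k))

  -- Polynomials in the divided-power basis

  -- Polynomials are lists of coefficients with respect to the divided powers t ^ k / k !, so that
  -- integration is consing 0ℚ and evaluation at t is ev (dpow t).
  ev : (ℕ → ℚ) → List ℚ → ℚ
  ev w []      = 0ℚ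
  ev w (c ∷ p) = w 0 * c + ev (w ∘ suc) p

  ev-cong : ∀ {w v} → (∀ k → w k ≡ v k) → ∀ p → ev w p ≡ ev v p
  ev-cong e []      = refl
  ev-cong e (c ∷ p) = cong₂ (λ a b → a * c + b) (e 0) (ev-cong (e ∘ suc) p)

  ev-linear : ∀ h w v p → ev (λ k → w k + h * v k) p ≡ ev w p + h * ev v p
  ev-linear h w v []      = sym (trans (ℚ.+-identityˡ _) (ℚ.*-zeroʳ h))
  ev-linear h w v (c ∷ p) = trans (cong ((w 0 + h * v 0) * c +_) (ev-linear h (w ∘ suc) (v ∘ suc) p))
    (solve 6 (λ a h b c x y → (a :+ h :* b) :* c :+ (x :+ h :* y) := a :* c :+ x :+ h :* (b :* c :+ y))
      refl (w 0) h (v 0) c _ _)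

  ev-mono-≤ : ∀ {w v} → (∀ k → w k ≤ v k) → ∀ {p} → All (0ℚ ≤_) p → ev w p ≤ ev v p
  ev-mono-≤ e []           = ℚ.≤-refl
  ev-mono-≤ e (0≤c ∷ 0≤p) = ℚ.+-mono-≤ (*-monoʳ-≤ 0≤c (e 0)) (ev-mono-≤ (e ∘ suc) 0≤p)

  0≤ev : ∀ {w} → (∀ k → 0ℚ ≤ w k) → ∀ {p} → All (0ℚ ≤_) p → 0ℚ ≤ ev w p
  0≤ev e []           = ℚ.≤-refl
  0≤ev e (0≤c ∷ 0≤p) = 0≤+ (0≤* (e 0) 0≤c) (0≤ev (e ∘ suc) 0≤p)

  -- Taylor's formula for `v = dpow x`: in this basis the derivatives of p are its tails, so the
  -- coefficients of p(s + x) as a polynomial in s are the values of the tails at x.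
  shift : (ℕ → ℚ) → List ℚ → List ℚ
  shift v []          = []
  shift v p@(_ ∷ q) = ev v p ∷ shift v q

  ev-shift : ∀ w v p → ev w (shift v p) ≡ ev (w ⋆ v) p
  ev-shift w v []      = refl
  ev-shift w v (c ∷ q) = begin
    w 0 * (v 0 * c + ev (v ∘ suc) q) + ev (w ∘ suc) (shift v q)
      ≡⟨ cong (w 0 * (v 0 * c + ev (v ∘ suc) q) +_) (ev-shift (w ∘ suc) v q) ⟩
    w 0 * (v 0 * c + ev (v ∘ suc) q) + ev ((w ∘ suc) ⋆ v) q
      ≡⟨ solve 5 (λ a b c x y → a :* (b :* c :+ x) :+ y := a :* b :* c :+ (y :+ a :* x)) refl (w 0) (v 0) c _ _ ⟩
    w 0 * v 0 * c + (ev ((w ∘ suc) ⋆ v) q + w 0 * ev (v ∘ suc) q)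
      ≡⟨ cong (w 0 * v 0 * c +_) (ev-linear (w 0) ((w ∘ suc) ⋆ v) (v ∘ suc) q) ⟨
    w 0 * v 0 * c + ev (λ k → ((w ∘ suc) ⋆ v) k + w 0 * v (suc k)) q
      ≡⟨ cong (w 0 * v 0 * c +_) (ev-cong (λ k → ℚ.+-comm (((w ∘ suc) ⋆ v) k) (w 0 * v (suc k))) q) ⟩
    ev (w ⋆ v) (c ∷ q) ∎
    where open ≡-Reasoning

  0≤shift : ∀ {v} → (∀ k → 0ℚ ≤ v k) → ∀ {p} → All (0ℚ ≤_) p → All (0ℚ ≤_) (shift v p)
  0≤shift e []             = []
  0≤shift e 0≤p@(_ ∷ 0≤q) = 0≤ev e 0≤p ∷ 0≤shift e 0≤q

  -- Slicing by the first coordinate gives vol Π(s + x₁, x₂, …) = ∫₀^{s + x₁} vol Π(u + x₂, x₃, …) du,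
  -- and poly xs is this volume as a polynomial in s.
  poly : ∀ {n} → Vec ℚ n → List ℚ
  poly []       = 1ℚ ∷ []
  poly (x ∷ xs) = shift (dpow x) (0ℚ ∷ poly xs)

  volume : ∀ {n} → ℚ → Vec ℚ n → ℚ
  volume s xs = ev (dpow s) (poly xs)

  volume-∷ : ∀ {n} s x (xs : Vec ℚ n) → volume s (x ∷ xs) ≡ ev (dpow (s + x)) (0ℚ ∷ poly xs)
  volume-∷ s x xs = trans (ev-shift (dpow s) (dpow x) (0ℚ ∷ poly xs))
                          (ev-cong (dpow-⋆ s x) (0ℚ ∷ poly xs))

  0≤poly : ∀ {n} {xs : Vec ℚ n} → VecAll.All (0ℚ ≤_) xs → All (0ℚ ≤_) (poly xs)
  0≤poly VecAll.[]           = 0≤1 ∷ []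
  0≤poly (0≤x VecAll.∷ 0≤xs) = 0≤shift (λ k → 0≤dpow k 0≤x) (ℚ.≤-refl ∷ 0≤poly 0≤xs)

  integral : List ℚ → ℚ → ℚ
  integral p u = ev (dpow u) (0ℚ ∷ p)

  integral-suc : ∀ p u → integral p u ≡ ev (dpow u ∘ suc) p
  integral-suc p u = trans (cong (_+ ev (dpow u ∘ suc) p) (ℚ.*-zeroʳ (dpow u 0))) (ℚ.+-identityˡ _)

  ev-zero : ∀ {w} → (∀ k → w k ≡ 0ℚ) → ∀ p → ev w p ≡ 0ℚ
  ev-zero w≡0 []      = refl
  ev-zero w≡0 (c ∷ p) = cong₂ _+_ (trans (cong (_* c) (w≡0 0)) (ℚ.*-zeroˡ c)) (ev-zero (w≡0 ∘ suc) p)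

  dpow-0-suc : ∀ k → dpow 0ℚ (suc k) ≡ 0ℚ
  dpow-0-suc k = trans (cong (_* recip! (suc k)) (ℚ.*-zeroˡ (0ℚ ^ℚ k))) (ℚ.*-zeroˡ (recip! (suc k)))

  integral-0 : ∀ p → integral p 0ℚ ≡ 0ℚ
  integral-0 p = trans (integral-suc p 0ℚ) (ev-zero dpow-0-suc p)

  module _ {p : List ℚ} (0≤p : All (0ℚ ≤_) p) {u h : ℚ} (0≤u : 0ℚ ≤ u) (0≤h : 0ℚ ≤ h) where

    integral-increment-≥ : integral p u + h * ev (dpow u) p ≤ integral p (u + h)
    integral-increment-≥ = subst₂ _≤_
      (trans (ev-linear h (dpow u ∘ suc) (dpow u) p) (cong (_+ h * ev (dpow u) p) (sym (integral-suc p u))))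
      (sym (integral-suc p (u + h)))
      (ev-mono-≤ (dpow-increment-≥ 0≤u 0≤h) 0≤p)

    integral-increment-≤ : integral p (u + h) ≤ integral p u + h * ev (dpow (u + h)) p
    integral-increment-≤ = subst₂ _≤_
      (sym (integral-suc p (u + h)))
      (trans (ev-linear h (dpow u ∘ suc) (dpow (u + h)) p)
        (cong (_+ h * ev (dpow (u + h)) p) (sym (integral-suc p u))))
      (ev-mono-≤ (dpow-increment-≤ 0≤u 0≤h) 0≤p)

  -- Rational boxes and Riemann sums

  record Interval : Set where
    constructor [_,_∣_]
    field
      lo hi : ℚ
      lo≤hi : lo ≤ hi

  open Interval public

  width : Interval → ℚ
  width i = hi i - lo i

  IntervalBox : ℕ → Set
  IntervalBox = Vec Interval

  content : ∀ {n} → IntervalBox n → ℚ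
  content []      = 1ℚ
  content (i ∷ b) = width i * content b

  totalContent : ∀ {n} → List (IntervalBox n) → ℚ
  totalContent []       = 0ℚ
  totalContent (b ∷ bs) = content b + totalContent bs

  totalContent-++ : ∀ {n} (bs cs : List (IntervalBox n)) →
    totalContent (bs ++ cs) ≡ totalContent bs + totalContent cs
  totalContent-++ []       cs = sym (ℚ.+-identityˡ _)
  totalContent-++ (b ∷ bs) cs =
    trans (cong (content b +_) (totalContent-++ bs cs)) (sym (ℚ.+-assoc (content b) _ _))

  totalContent-map-∷ : ∀ {n} i (bs : List (IntervalBox n)) →
    totalContent (List.map (i ∷_) bs) ≡ width i * totalContent bs
  totalContent-map-∷ i []       = sym (ℚ.*-zeroʳ (width i))
  totalContent-map-∷ i (b ∷ bs) =
    trans (cong (width i * content b +_) (totalContent-map-∷ i bs))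
      (sym (ℚ.*-distribˡ-+ (width i) (content b) _))

  -- InRegion s xs is Π with s added to every partial sum of xs.
  InRegion : ∀ {n} → ℚ → Vec ℚ n → Vec ℚ n → Set
  InRegion s []       []       = ⊤
  InRegion s (x ∷ xs) (q ∷ qs) = 0ℚ ≤ q × q ≤ s + x × InRegion (s + x - q) xs qs

  InRegion-mono : ∀ {n s t} (xs qs : Vec ℚ n) → s ≤ t → InRegion s xs qs → InRegion t xs qs
  InRegion-mono []       []       s≤t _               = tt
  InRegion-mono (x ∷ xs) (q ∷ qs) s≤t (0≤q , q≤ , rest) =
    0≤q , ℚ.≤-trans q≤ s+x≤ , InRegion-mono xs qs (ℚ.+-monoˡ-≤ (- q) s+x≤) rest
    where s+x≤ = ℚ.+-monoˡ-≤ x s≤t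

  InBox : ∀ {n} → Vec ℚ n → IntervalBox n → Set
  InBox []       []      = ⊤
  InBox (q ∷ qs) (i ∷ b) = lo i ≤ q × q < hi i × InBox qs b

  -- The worst corner decides: sums are largest where each coordinate equals `hi`, so the slack
  -- passed on is measured there, while nonnegativity is tested at `lo`.
  Inside : ∀ {n} → ℚ → Vec ℚ n → IntervalBox n → Set
  Inside s []       []      = ⊤
  Inside s (x ∷ xs) (i ∷ b) = 0ℚ ≤ lo i × hi i ≤ s + x × Inside (s + x - hi i) xs b

  -- Disjointness with a witnessing coordinate, so that it survives prefixing a further interval to
  -- both boxes. Two boxes of dimension zero share their only point.
  Separated : ∀ {n} → IntervalBox n → IntervalBox n → Set
  Separated []      []      = ⊥
  Separated (i ∷ b) (j ∷ c) = (hi i ≤ lo j ⊎ hi j ≤ lo i) ⊎ Separated b c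

  -- The Archimedean property and fine meshes

  -- The absolute value of the numerator is large enough, because the denominator is at least 1.
  archimedean : ∀ p → ∃ λ n → p ≤ fromℕℚ n
  archimedean p@(ℚ.mkℚ z d-1 _) = ℤ.∣ z ∣ , ℚ.toℚᵘ-cancel-≤ (begin
    ℚ.toℚᵘ p                      ≤⟨ ℚᵘ.*≤* (z*1≤ z) ⟩
    ℚᵘ.mkℚᵘ (ℤ.+ ℤ.∣ z ∣) 0       ≃⟨ ℚ.toℚᵘ-fromℚᵘ (ℚᵘ.mkℚᵘ (ℤ.+ ℤ.∣ z ∣) 0) ⟨
    ℚ.toℚᵘ (fromℕℚ ℤ.∣ z ∣)       ∎)
    where
    open ℚᵘ.≤-Reasoning
    z*1≤ : ∀ z → z ℤ.* ℤ.+ 1 ℤ.≤ ℤ.+ ℤ.∣ z ∣ ℤ.* ℤ.+ suc d-1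
    z*1≤ (ℤ.+ n)    = subst₂ ℤ._≤_ (sym (ℤ.*-identityʳ (ℤ.+ n))) (ℤ.pos-* n (suc d-1))
                        (ℤ.+≤+ (ℕ.m≤m*n n (suc d-1)))
    z*1≤ ℤ.-[1+ n ] = ℤ.-≤+

  pos-inverse : ∀ {p} → 0ℚ < p → ∃ λ q → 0ℚ < q × p * q ≡ 1ℚ
  pos-inverse {p} 0<p = ℚ.1/ p , ℚ.positive⁻¹ (ℚ.1/ p) {{ℚ.1/pos⇒pos p}} , ℚ.*-inverseʳ p
    where
    instance
      p⁺ : ℚ.Positive p
      p⁺ = ℚ.positive 0<p
      p≢0 : ℚ.NonZero p
      p≢0 = ℚ.pos⇒nonZero p

  archimedean-* : ∀ r {η} → 0ℚ < η → ∃ λ n → r ≤ fromℕℚ n * η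
  archimedean-* r {η} 0<η =
    let η⁻¹ , 0<η⁻¹ , ηη⁻¹≡1 = pos-inverse 0<η
        n , rη⁻¹≤n = archimedean (r * η⁻¹)
    in n , subst (_≤ fromℕℚ n * η)
         (trans (ℚ.*-assoc r η⁻¹ η) (trans (cong (r *_) (trans (ℚ.*-comm η⁻¹ η) ηη⁻¹≡1)) (ℚ.*-identityʳ r)))
         (*-monoʳ-≤ (ℚ.<⇒≤ 0<η) rη⁻¹≤n)

  -- The witness is ε / (1 + a); the added 1 makes the divisor positive even for a = 0.
  small-factor : ∀ {a ε} → 0ℚ ≤ a → 0ℚ < ε → ∃ λ δ → 0ℚ < δ × a * δ ≤ ε
  small-factor {a} {ε} 0≤a 0<ε =
    let δ , 0<δ , eq = pos-inverse {1ℚ + a} (0<+ 0<1 0≤a)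
        0<δε = 0<* 0<δ 0<ε
    in δ * ε , 0<δε , ℚ.≤-trans
         (*-monoʳ-≤ {p = a} (ℚ.<⇒≤ 0<δε) (≤-by {p = a} 1ℚ 0≤1 (ℚ.+-comm 1ℚ a)))
         (ℚ.≤-reflexive (trans (sym (ℚ.*-assoc (1ℚ + a) δ ε)) (trans (cong (_* ε) eq) (ℚ.*-identityˡ ε))))

  half : ∀ {ε} → 0ℚ < ε → 0ℚ < ½ * ε
  half = 0<* (ℚ.positive⁻¹ ½)

  half+half : ∀ ε → ½ * ε + ½ * ε ≡ ε
  half+half ε = trans (sym (ℚ.*-distribʳ-+ ε ½ ½)) (ℚ.*-identityˡ ε)

  -- Recursive rather than `fromℕℚ j * h`, so that one more step unfolds to `steps h j + h` in the
  -- induction over slabs.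
  steps : ℚ → ℕ → ℚ
  steps h zero    = 0ℚ
  steps h (suc j) = steps h j + h

  0≤steps : ∀ {h} → 0ℚ ≤ h → ∀ j → 0ℚ ≤ steps h j
  0≤steps 0≤h zero    = ℚ.≤-refl
  0≤steps 0≤h (suc j) = 0≤+ (0≤steps 0≤h j) 0≤h

  steps≡* : ∀ h j → steps h j ≡ fromℕℚ j * h
  steps≡* h zero    = sym (ℚ.*-zeroˡ h)
  steps≡* h (suc j) = trans (cong (_+ h) (steps≡* h j))
    (trans (solve 2 (λ a h → a :* h :+ h := (con 1ℚ :+ a) :* h) refl (fromℕℚ j) h)
      (cong (_* h) (sym (fromℕℚ-suc j))))

  mesh : ∀ {r η} → 0ℚ < r → 0ℚ < η →
    ∃ λ h → ∃ λ j → 0ℚ < h × h ≤ r × h ≤ η × steps h j ≡ r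
  mesh {r} {η} 0<r 0<η =
    let n , r≤nη = archimedean-* r 0<η
        -- Dividing r into `suc n` parts keeps the divisor visibly positive; the additional part
        -- only refines the mesh.
        n⁻¹ , 0<n⁻¹ , nn⁻¹≡1 = pos-inverse (0<fromℕℚ-suc n)
        h = n⁻¹ * r
        0<h = 0<* 0<n⁻¹ 0<r
        nh≡r = trans (sym (ℚ.*-assoc (fromℕℚ (suc n)) n⁻¹ r)) (trans (cong (_* r) nn⁻¹≡1) (ℚ.*-identityˡ r))
        steps≡r = trans (steps≡* h (suc n)) nh≡r
        n≤suc = ℚ.≤-trans (≤-by {p = fromℕℚ n} 1ℚ 0≤1 (ℚ.+-comm 1ℚ (fromℕℚ n))) (ℚ.≤-reflexive (sym (fromℕℚ-suc n)))
    in h , suc n , 0<h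
       , subst (h ≤_) steps≡r (≤-by (steps h n) (0≤steps (ℚ.<⇒≤ 0<h) n) (ℚ.+-comm (steps h n) h))
       , *-cancelˡ-≤-suc n (ℚ.≤-trans (ℚ.≤-reflexive nh≡r)
           (ℚ.≤-trans r≤nη (*-monoʳ-≤ {p = fromℕℚ n} (ℚ.<⇒≤ 0<η) n≤suc)))
       , steps≡r

  -- Covers and packings by slabs

  OuterCover : ∀ {n} → ℚ → Vec ℚ n → ℚ → Set
  OuterCover {n} s xs ε = Σ (List (IntervalBox n)) λ bs →
    (∀ qs → InRegion s xs qs → Any (InBox qs) bs) ×
    totalContent bs ≤ volume s xs + ε

  InnerPacking : ∀ {n} → ℚ → Vec ℚ n → ℚ → Set
  InnerPacking {n} s xs ε = Σ (List (IntervalBox n)) λ bs →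
    AllPairs Separated bs × All (Inside s xs) bs ×
    volume s xs ≤ totalContent bs + ε

  -- Slabs are stacked downwards from q = r: the section at q has slack r - q, so in the variable u
  -- = r - q the sums run from 0 to r and `U j` is the depth reached after j steps.
  module Slices {n} (xs : Vec ℚ n) (0≤xs : VecAll.All (0ℚ ≤_) xs) (r h δ : ℚ) (0<h : 0ℚ < h) where

    private
      p = poly xs
      0≤p = 0≤poly 0≤xs
      F = integral p
      f = λ u → volume u xs
      0≤h = ℚ.<⇒≤ 0<h
      U = steps h

    module _ (cover : ∀ u → 0ℚ ≤ u → OuterCover u xs δ) where

      -- Each slab uses its largest section. The excess over the integral telescopes to the last
      -- term, because the preceding `h * f (U j)` is absorbed by the growth of `F` over the next
      -- step. There are j + 1 slabs of width h, whence `(U j + h) * δ`.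
      OuterSlabs : ℕ → Set
      OuterSlabs j = Σ (List (IntervalBox (suc n))) λ bs →
        (∀ q qs → r - U j ≤ q → q ≤ r → InRegion (r - q) xs qs → Any (InBox (q ∷ qs)) bs) ×
        totalContent bs ≤ F (U j) + h * f (U j) + (U j + h) * δ

      private
        module Slab (u : ℚ) (0≤u : 0ℚ ≤ u) where
          interval : Interval
          interval = [ r - u , r - u + h ∣ ≤-by h 0≤h refl ]

          boxes = proj₁ (cover u 0≤u)

          slab = List.map (interval ∷_) boxes

          slab-covers : ∀ q qs → r - u ≤ q → q < r - u + h → InRegion (r - q) xs qs →
                        Any (InBox (q ∷ qs)) slab
          slab-covers q qs r-u≤q q< reg = Any.map⁺ (Any.map (λ c → r-u≤q , q< , c)
            (proj₁ (proj₂ (cover u 0≤u)) qs (InRegion-mono xs qs r-q≤u reg)))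
            where
            r-q≤u : r - q ≤ u
            r-q≤u = ≤-by (q - (r - u)) (0≤-difference r-u≤q)
              (solve 3 (λ r q u → u := r :- q :+ (q :- (r :- u))) refl r q u)

          slab-content : totalContent slab ≤ h * f u + h * δ
          slab-content = begin
            totalContent slab                  ≡⟨ totalContent-map-∷ interval boxes ⟩
            (r - u + h - (r - u)) * totalContent boxes
              ≡⟨ cong (_* totalContent boxes) (solve 2 (λ a h → a :+ h :- a := h) refl (r - u) h) ⟩
            h * totalContent boxes             ≤⟨ *-monoˡ-≤ 0≤h (proj₂ (proj₂ (cover u 0≤u))) ⟩
            h * (f u + δ)                      ≡⟨ ℚ.*-distribˡ-+ h (f u) δ ⟩
            h * f u + h * δ                    ∎
            where open ℚ.≤-Reasoning

      outerSlabs : ∀ j → OuterSlabs j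
      -- The slab over [r , r + h) catches the face q = r, which half-open intervals ending at r
      -- would miss.
      outerSlabs zero = slab , covers , bound
        where
        open Slab 0ℚ ℚ.≤-refl
        r-0≡r : r - 0ℚ ≡ r
        r-0≡r = solve 1 (λ r → r :- con 0ℚ := r) refl r
        covers : ∀ q qs → r - 0ℚ ≤ q → q ≤ r → InRegion (r - q) xs qs → Any (InBox (q ∷ qs)) slab
        covers q qs r≤q q≤r = slab-covers q qs r≤q (ℚ.≤-<-trans q≤r
          (subst₂ _<_ (ℚ.+-identityʳ r) (cong (_+ h) (sym r-0≡r)) (ℚ.+-monoʳ-< r 0<h)))
        open ℚ.≤-Reasoning
        bound : totalContent slab ≤ F 0ℚ + h * f 0ℚ + (0ℚ + h) * δ
        bound = begin
          totalContent slab              ≤⟨ slab-content ⟩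
          h * f 0ℚ + h * δ               ≡⟨ solve 3 (λ a h d → a :+ h :* d := con 0ℚ :+ a :+ (con 0ℚ :+ h) :* d) refl (h * f 0ℚ) h δ ⟩
          0ℚ + h * f 0ℚ + (0ℚ + h) * δ   ≡⟨ cong (λ z → z + h * f 0ℚ + (0ℚ + h) * δ) (integral-0 p) ⟨
          F 0ℚ + h * f 0ℚ + (0ℚ + h) * δ ∎
      outerSlabs (suc j) with outerSlabs j
      ... | bs , covers′ , bound′ = slab ++ bs , covers , bound
        where
        open Slab (U (suc j)) (0≤steps 0≤h (suc j))
        u = U j
        covers : ∀ q qs → r - U (suc j) ≤ q → q ≤ r → InRegion (r - q) xs qs →
                 Any (InBox (q ∷ qs)) (slab ++ bs)
        covers q qs ≤q q≤r reg with r - u ℚ.≤? q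
        ... | yes r-u≤q = Any.++⁺ʳ slab (covers′ q qs r-u≤q q≤r reg)
        ... | no  r-u≰q = Any.++⁺ˡ (slab-covers q qs ≤q
          (subst (q <_) (solve 3 (λ r u h → r :- u := r :- (u :+ h) :+ h) refl r u h) (ℚ.≰⇒> r-u≰q)) reg)
        open ℚ.≤-Reasoning
        bound : totalContent (slab ++ bs) ≤ F (u + h) + h * f (u + h) + (u + h + h) * δ
        bound = begin
          totalContent (slab ++ bs)           ≡⟨ totalContent-++ slab bs ⟩
          totalContent slab + totalContent bs ≤⟨ ℚ.+-mono-≤ slab-content bound′ ⟩
          h * f (u + h) + h * δ + (F u + h * f u + (u + h) * δ)
            ≡⟨ solve 5 (λ a h d b u → a :+ h :* d :+ (b :+ (u :+ h) :* d) := b :+ a :+ (u :+ h :+ h) :* d) refl (h * f (u + h)) h δ (F u + h * f u) u ⟩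
          F u + h * f u + h * f (u + h) + (u + h + h) * δ
            ≤⟨ ℚ.+-monoˡ-≤ ((u + h + h) * δ) (ℚ.+-monoˡ-≤ (h * f (u + h)) (integral-increment-≥ 0≤p (0≤steps 0≤h j) 0≤h)) ⟩
          F (u + h) + h * f (u + h) + (u + h + h) * δ ∎

    module _ (packing : ∀ u → 0ℚ ≤ u → InnerPacking u xs δ) where

      -- The lower bound `r - U j` replaces the 0 of `Inside`; it is what separates the next slab
      -- from all earlier ones.
      InSlabs : ℕ → IntervalBox (suc n) → Set
      InSlabs j (i ∷ b) = r - U j ≤ lo i × hi i ≤ r × Inside (r - hi i) xs b

      -- Each slab uses its smallest section. The pending `h * f (U j)` is paid, up to `h * δ`, by
      -- the next slab, whose sections are those at depth `U j`; the increment of `F` then creates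
      -- the next pending term.
      InnerSlabs : ℕ → Set
      InnerSlabs j = Σ (List (IntervalBox (suc n))) λ bs →
        AllPairs Separated bs × All (InSlabs j) bs ×
        F (U j) ≤ totalContent bs + h * f (U j) + U j * δ

      innerSlabs : ∀ j → InnerSlabs j
      innerSlabs zero = [] , [] , [] , (begin
        F 0ℚ                             ≡⟨ integral-0 p ⟩
        0ℚ                               ≤⟨ 0≤* 0≤h (0≤ev (λ k → 0≤dpow k ℚ.≤-refl) 0≤p) ⟩
        h * f 0ℚ                         ≡⟨ solve 2 (λ a d → a := con 0ℚ :+ a :+ con 0ℚ :* d) refl (h * f 0ℚ) δ ⟩
        0ℚ + h * f 0ℚ + 0ℚ * δ           ∎)
        where open ℚ.≤-Reasoning
      innerSlabs (suc j) with innerSlabs j | packing (U j) (0≤steps 0≤h j)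
      ... | bs , sep′ , inside′ , bound′ | cs , sep , inside , bound =
        slab ++ bs
        , AllPairs.++⁺ (AllPairs.map⁺ (AllPairs.map inj₂ sep)) sep′
            (All.map⁺ (All.universal (λ c → All.map (apart c) inside′) cs))
        , All.++⁺ (All.map⁺ (All.map (λ {c} → new c) inside)) (All.map (λ {b} → old b) inside′)
        , bound″
        where
        u = U j
        interval : Interval
        interval = [ r - U (suc j) , r - u ∣ ≤-by h 0≤h
          (solve 3 (λ r u h → r :- u := r :- (u :+ h) :+ h) refl r u h) ]
        slab = List.map (interval ∷_) cs
        apart : ∀ c {b} → InSlabs j b → Separated (interval ∷ c) b
        apart c {i ∷ b} (≤lo , _) = inj₁ (inj₁ ≤lo)
        new : ∀ c → Inside u xs c → InSlabs (suc j) (interval ∷ c)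
        new c ins = ℚ.≤-refl
          , ≤-by u (0≤steps 0≤h j) (solve 2 (λ r u → r := r :- u :+ u) refl r u)
          , subst (λ s → Inside s xs c) (solve 2 (λ r u → u := r :- (r :- u)) refl r u) ins
        old : ∀ b → InSlabs j b → InSlabs (suc j) b
        old (i ∷ b) (≤lo , hi≤ , ins) = ℚ.≤-trans (lo≤hi interval) ≤lo , hi≤ , ins
        open ℚ.≤-Reasoning
        bound″ : F (u + h) ≤ totalContent (slab ++ bs) + h * f (u + h) + (u + h) * δ
        bound″ = begin
          F (u + h)                                   ≤⟨ integral-increment-≤ 0≤p (0≤steps 0≤h j) 0≤h ⟩
          F u + h * f (u + h)                         ≤⟨ ℚ.+-monoˡ-≤ (h * f (u + h)) bound′ ⟩
          totalContent bs + h * f u + u * δ + h * f (u + h)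
            ≤⟨ ℚ.+-monoˡ-≤ (h * f (u + h)) (ℚ.+-monoˡ-≤ (u * δ) (ℚ.+-monoʳ-≤ (totalContent bs) (*-monoˡ-≤ 0≤h bound))) ⟩
          totalContent bs + h * (totalContent cs + δ) + u * δ + h * f (u + h)
            ≡⟨ solve 7 (λ τ h C d u f r → τ :+ h :* (C :+ d) :+ u :* d :+ f := (r :- u :- (r :- (u :+ h))) :* C :+ τ :+ f :+ (u :+ h) :* d)
                 refl (totalContent bs) h (totalContent cs) δ u (h * f (u + h)) r ⟩
          width interval * totalContent cs + totalContent bs + h * f (u + h) + (u + h) * δ
            ≡⟨ cong (λ z → z + h * f (u + h) + (u + h) * δ)
                 (trans (cong (_+ totalContent bs) (sym (totalContent-map-∷ interval cs)))
                        (sym (totalContent-++ slab bs))) ⟩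
          totalContent (slab ++ bs) + h * f (u + h) + (u + h) * δ ∎

  module _ {n} {xs : Vec ℚ n} (0≤xs : VecAll.All (0ℚ ≤_) xs) {r ε : ℚ} (0<r : 0ℚ < r) (0<ε : 0ℚ < ε) where

    private
      f = volume r xs

      0≤f : 0ℚ ≤ f
      0≤f = 0≤ev (λ k → 0≤dpow k (ℚ.<⇒≤ 0<r)) (0≤poly 0≤xs)

    -- Both error terms of the Riemann sums, h f(r) and (r + h) δ, are at most ε / 2.
    fineMesh : ∃ λ h → ∃ λ j → ∃ λ δ → 0ℚ < h × 0ℚ < δ × steps h j ≡ r × h * f + (r + h) * δ ≤ ε
    fineMesh =
      let η , 0<η , fη≤ = small-factor 0≤f (half 0<ε)
          h , j , 0<h , h≤r , h≤η , eq = mesh 0<r 0<η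
          δ , 0<δ , rδ≤ = small-factor (ℚ.<⇒≤ (0<+ 0<r (ℚ.<⇒≤ 0<h))) (half 0<ε)
      in h , j , δ , 0<h , 0<δ , eq , (begin
           h * f + (r + h) * δ   ≤⟨ ℚ.+-mono-≤ (*-monoʳ-≤ 0≤f h≤η) rδ≤ ⟩
           η * f + ½ * ε         ≡⟨ cong (_+ ½ * ε) (ℚ.*-comm η f) ⟩
           f * η + ½ * ε         ≤⟨ ℚ.+-monoˡ-≤ (½ * ε) fη≤ ⟩
           ½ * ε + ½ * ε         ≡⟨ half+half ε ⟩
           ε                     ∎)
      where open ℚ.≤-Reasoning

  outerCover : ∀ {n} {xs : Vec ℚ n} → VecAll.All (0ℚ <_) xs → ∀ {s ε} → 0ℚ ≤ s → 0ℚ < ε → OuterCover s xs ε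
  outerCover {xs = []} _ {s} {ε} 0≤s 0<ε = [] ∷ [] , (λ { [] _ → here tt }) , ≤-by ε (ℚ.<⇒≤ 0<ε) refl
  outerCover {xs = x ∷ xs} (0<x VecAll.∷ 0<xs) {s} {ε} 0≤s 0<ε = build (fineMesh 0≤xs 0<r 0<ε)
    where
    r = s + x
    0<r : 0ℚ < r
    0<r = ℚ.+-mono-≤-< 0≤s 0<x
    0≤xs = VecAll.map ℚ.<⇒≤ 0<xs
    build : (∃ λ h → ∃ λ j → ∃ λ δ → 0ℚ < h × 0ℚ < δ × steps h j ≡ r × h * volume r xs + (r + h) * δ ≤ ε) →
            OuterCover s (x ∷ xs) ε
    build (h , j , δ , 0<h , 0<δ , eq , small)
      with Slices.outerSlabs xs 0≤xs r h δ 0<h (λ u 0≤u → outerCover 0<xs 0≤u 0<δ) j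
    ... | bs , covers , bound = bs
        , (λ { (q ∷ qs) (0≤q , q≤r , reg) → covers q qs
             (ℚ.≤-trans (ℚ.≤-reflexive (trans (cong (λ u → r - u) eq) (ℚ.+-inverseʳ r))) 0≤q) q≤r reg })
        , (begin
           totalContent bs                                      ≤⟨ bound ⟩
           integral p (steps h j) + h * volume (steps h j) xs + (steps h j + h) * δ
             ≡⟨ cong (λ u → integral p u + h * volume u xs + (u + h) * δ) eq ⟩
           integral p r + h * volume r xs + (r + h) * δ         ≡⟨ ℚ.+-assoc (integral p r) _ _ ⟩
           integral p r + (h * volume r xs + (r + h) * δ)       ≤⟨ ℚ.+-monoʳ-≤ (integral p r) small ⟩
           integral p r + ε                                     ≡⟨ cong (_+ ε) (volume-∷ s x xs) ⟨
           volume s (x ∷ xs) + ε                                ∎)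
      where
      open ℚ.≤-Reasoning
      p = poly xs

  innerPacking : ∀ {n} {xs : Vec ℚ n} → VecAll.All (0ℚ <_) xs → ∀ {s ε} → 0ℚ ≤ s → 0ℚ < ε → InnerPacking s xs ε
  innerPacking {xs = []} _ {s} {ε} 0≤s 0<ε = [] ∷ [] , [] ∷ [] , tt ∷ [] , ≤-by ε (ℚ.<⇒≤ 0<ε) refl
  innerPacking {xs = x ∷ xs} (0<x VecAll.∷ 0<xs) {s} {ε} 0≤s 0<ε = build (fineMesh 0≤xs 0<r 0<ε)
    where
    r = s + x
    0<r : 0ℚ < r
    0<r = ℚ.+-mono-≤-< 0≤s 0<x
    0≤xs = VecAll.map ℚ.<⇒≤ 0<xs
    build : (∃ λ h → ∃ λ j → ∃ λ δ → 0ℚ < h × 0ℚ < δ × steps h j ≡ r × h * volume r xs + (r + h) * δ ≤ ε) →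
            InnerPacking s (x ∷ xs) ε
    build (h , j , δ , 0<h , 0<δ , eq , small)
      with Slices.innerSlabs xs 0≤xs r h δ 0<h (λ u 0≤u → innerPacking 0<xs 0≤u 0<δ) j
    ... | bs , sep , inside , bound = bs , sep , All.map (λ {b} → toInside b) inside
        , (begin
           volume s (x ∷ xs)                                    ≡⟨ volume-∷ s x xs ⟩
           integral p r                                         ≡⟨ cong (integral p) eq ⟨
           integral p (steps h j)                               ≤⟨ bound ⟩
           τ + h * volume (steps h j) xs + steps h j * δ
             ≡⟨ cong (λ u → τ + h * volume u xs + u * δ) eq ⟩
           τ + h * volume r xs + r * δ
             ≤⟨ ≤-by (h * δ) (0≤* (ℚ.<⇒≤ 0<h) (ℚ.<⇒≤ 0<δ))
                  (solve 5 (λ τ h v r d → τ :+ (h :* v :+ (r :+ h) :* d) := τ :+ h :* v :+ r :* d :+ h :* d) refl τ h (volume r xs) r δ) ⟩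
           τ + (h * volume r xs + (r + h) * δ)                  ≤⟨ ℚ.+-monoʳ-≤ τ small ⟩
           τ + ε                                                ∎)
      where
      open ℚ.≤-Reasoning
      p = poly xs
      τ = totalContent bs
      toInside : ∀ b → _ → Inside s (x ∷ xs) b
      toInside (i ∷ b) (≤lo , hi≤ , ins) =
        subst (_≤ lo i) (trans (cong (λ u → r - u) eq) (ℚ.+-inverseʳ r)) ≤lo , hi≤ , ins

  -- Finite sums and coefficient extraction

  sumℚ : List ℚ → ℚ
  sumℚ = List.foldr _+_ 0ℚ

  ∏ℚ : ∀ {n} → Vec ℚ n → ℚ
  ∏ℚ = Vec.foldr′ _*_ 1ℚ

  sumℚ-++ : ∀ ps qs → sumℚ (ps ++ qs) ≡ sumℚ ps + sumℚ qs
  sumℚ-++ []       qs = sym (ℚ.+-identityˡ _)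
  sumℚ-++ (p ∷ ps) qs = trans (cong (p +_) (sumℚ-++ ps qs)) (sym (ℚ.+-assoc p _ _))

  module _ {A : Set} where

    sumℚ-*ˡ : ∀ c (f : A → ℚ) as → sumℚ (List.map (λ a → c * f a) as) ≡ c * sumℚ (List.map f as)
    sumℚ-*ˡ c f []       = sym (ℚ.*-zeroʳ c)
    sumℚ-*ˡ c f (a ∷ as) = trans (cong (c * f a +_) (sumℚ-*ˡ c f as)) (sym (ℚ.*-distribˡ-+ c (f a) _))

    sumℚ-zero : ∀ (as : List A) → sumℚ (List.map (λ _ → 0ℚ) as) ≡ 0ℚ
    sumℚ-zero []       = refl
    sumℚ-zero (a ∷ as) = trans (ℚ.+-identityˡ _) (sumℚ-zero as)

    sumℚ-cong : ∀ {f g : A → ℚ} {as} → All (λ a → f a ≡ g a) as →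
      sumℚ (List.map f as) ≡ sumℚ (List.map g as)
    sumℚ-cong []       = refl
    sumℚ-cong (e ∷ es) = cong₂ _+_ e (sumℚ-cong es)

    -- Trading the filter for an indicator leaves a sum over all bounded vectors, which splits
    -- coordinate by coordinate.
    sumℚ-filter : ∀ {P : A → Set} (P? : Decidable P) (f : A → ℚ) as →
      sumℚ (List.map f (List.filter P? as)) ≡
      sumℚ (List.map (λ a → if does (P? a) then f a else 0ℚ) as)
    sumℚ-filter P? f []       = refl
    sumℚ-filter P? f (a ∷ as) with does (P? a)
    ... | true  = cong (f a +_) (sumℚ-filter P? f as)
    ... | false = trans (sumℚ-filter P? f as) (sym (ℚ.+-identityˡ _))

  sumℚ-boundedVecs : ∀ {n} (f : Vec ℕ (suc n) → ℚ) as (ks : List (Vec ℕ n)) →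
    sumℚ (List.map f (List.cartesianProductWith _∷_ as ks)) ≡
    sumℚ (List.map (λ a → sumℚ (List.map (f ∘ (a ∷_)) ks)) as)
  sumℚ-boundedVecs f []       ks = refl
  sumℚ-boundedVecs f (a ∷ as) ks = begin
    sumℚ (List.map f (List.map (a ∷_) ks ++ rest))
      ≡⟨ cong sumℚ (List.map-++ f (List.map (a ∷_) ks) rest) ⟩
    sumℚ (List.map f (List.map (a ∷_) ks) ++ List.map f rest)
      ≡⟨ sumℚ-++ (List.map f (List.map (a ∷_) ks)) (List.map f rest) ⟩
    sumℚ (List.map f (List.map (a ∷_) ks)) + sumℚ (List.map f rest)
      ≡⟨ cong₂ _+_ (cong sumℚ (sym (List.map-∘ ks))) (sumℚ-boundedVecs f as ks) ⟩
    sumℚ (List.map (λ a → sumℚ (List.map (f ∘ (a ∷_)) ks)) (a ∷ as)) ∎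
    where
    open ≡-Reasoning
    rest = List.cartesianProductWith _∷_ as ks

  coefficient : ℕ → List ℚ → ℚ
  coefficient e       []      = 0ℚ
  coefficient zero    (c ∷ p) = c
  coefficient (suc e) (c ∷ p) = coefficient e p

  coefficient-+ : ∀ e a p → coefficient (e ℕ.+ a) p ≡ coefficient a (List.drop e p)
  coefficient-+ zero    a p       = refl
  coefficient-+ (suc e) a []      = refl
  coefficient-+ (suc e) a (c ∷ p) = coefficient-+ e a p

  coefficient-shift : ∀ v e p → coefficient e (shift v p) ≡ ev v (List.drop e p)
  coefficient-shift v zero    []      = refl
  coefficient-shift v (suc e) []      = refl
  coefficient-shift v zero    (c ∷ p) = refl
  coefficient-shift v (suc e) (c ∷ p) = coefficient-shift v e p

  length-shift : ∀ v p → List.length (shift v p) ≡ List.length p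
  length-shift v []      = refl
  length-shift v (c ∷ p) = cong suc (length-shift v p)

  length-poly : ∀ {n} (xs : Vec ℚ n) → List.length (poly xs) ≡ suc n
  length-poly []       = refl
  length-poly (x ∷ xs) = trans (length-shift (dpow x) (0ℚ ∷ poly xs)) (cong suc (length-poly xs))

  sumℚ-applyUpTo-zero : ∀ (f : ℕ → ℚ) → (∀ a → f a ≡ 0ℚ) → ∀ m → sumℚ (List.applyUpTo f m) ≡ 0ℚ
  sumℚ-applyUpTo-zero f f≡0 zero    = refl
  sumℚ-applyUpTo-zero f f≡0 (suc m) = cong₂ _+_ (f≡0 0) (sumℚ-applyUpTo-zero (f ∘ suc) (f≡0 ∘ suc) m)

  ev-sumℚ : ∀ w p m → List.length p ℕ.≤ m →
    sumℚ (List.applyUpTo (λ a → w a * coefficient a p) m) ≡ ev w p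
  ev-sumℚ w []      m       _        = sumℚ-applyUpTo-zero _ (λ a → ℚ.*-zeroʳ (w a)) m
  ev-sumℚ w (c ∷ p) (suc m) (s≤s le) = cong (w 0 * c +_) (ev-sumℚ (w ∘ suc) p m le)

  -- Ballot vectors and the sum over K

  -- good k e : with e units in advance, the partial sums of k stay above the diagonal
  -- and end on it.
  good : ∀ {n} → Vec ℕ n → ℕ → Bool
  goodAfter : ∀ {n} → ℕ → Vec ℕ n → Bool
  good []      zero    = true
  good []      (suc _) = false
  good (a ∷ k) e       = goodAfter (e ℕ.+ a) k
  goodAfter zero    k = false
  goodAfter (suc m) k = good k m

  Ballot : ∀ {n} → ℕ → Vec ℕ n → Set
  Ballot {n} e k =
    (∀ j → j ℕ.≤ n → j ℕ.≤ e ℕ.+ ListAction.sum (List.take j (toList k))) ×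
    e ℕ.+ Vec.sum k ≡ n

  Ballot⇒good : ∀ {n} e (k : Vec ℕ n) → Ballot e k → T (good k e)
  Ballot⇒good zero    []      _        = tt
  Ballot⇒good (suc e) []      (_ , ())
  Ballot⇒good {suc n} e (a ∷ k) (partial , total) = after (e ℕ.+ a) refl
    where
    after : ∀ m → e ℕ.+ a ≡ m → T (goodAfter m k)
    -- If e + a = 0, the ballot condition fails already at j = 1.
    after zero    eq = ℕ.n≮0 {0} (subst (1 ℕ.≤_)
      (trans (sym (ℕ.+-assoc e a 0)) (trans (ℕ.+-identityʳ (e ℕ.+ a)) eq)) (partial 1 (s≤s z≤n)))
    after (suc m) eq = Ballot⇒good m k
      ( (λ j j≤n → ℕ.s≤s⁻¹ (subst (suc j ℕ.≤_) (regroup (ListAction.sum (List.take j (toList k))))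
          (partial (suc j) (s≤s j≤n))))
      , ℕ.suc-injective (trans (sym (regroup (Vec.sum k))) total))
      where
      regroup : ∀ z → e ℕ.+ (a ℕ.+ z) ≡ suc m ℕ.+ z
      regroup z = trans (sym (ℕ.+-assoc e a z)) (cong (ℕ._+ z) eq)

  good⇒Ballot : ∀ {n} e (k : Vec ℕ n) → T (good k e) → Ballot e k
  good⇒Ballot zero    []      _ = (λ { zero _ → z≤n }) , refl
  good⇒Ballot {suc n} e (a ∷ k) g = after (e ℕ.+ a) refl g
    where
    after : ∀ m → e ℕ.+ a ≡ m → T (goodAfter m k) → Ballot e (a ∷ k)
    after (suc m) eq g with good⇒Ballot m k g
    ... | partial , total =
      (λ { zero _ → z≤n
         ; (suc j) (s≤s j≤n) → subst (suc j ℕ.≤_) (sym (regroup _)) (s≤s (partial j j≤n)) })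
      , trans (regroup (Vec.sum k)) (cong suc total)
      where
      regroup : ∀ z → e ℕ.+ (a ℕ.+ z) ≡ suc m ℕ.+ z
      regroup z = trans (sym (ℕ.+-assoc e a z)) (cong (ℕ._+ z) eq)

  sum-take-all : ∀ {n} (k : Vec ℕ n) → ListAction.sum (List.take n (toList k)) ≡ Vec.sum k
  sum-take-all []      = refl
  sum-take-all (a ∷ k) = cong (a ℕ.+_) (sum-take-all k)

  InK⇔Ballot : ∀ {n} (k : Vec ℕ n) → InK k ⇔ Ballot 0 k
  InK⇔Ballot {n} k = mk⇔ to (λ (partial , total) →
    (λ j _ j≤ → partial j (ℕ.≤-trans j≤ (ℕ.m∸n≤m n 1))) , total)
    where
    to : InK k → Ballot 0 k
    to (partial , total) = go , total
      where
      go : ∀ j → j ℕ.≤ n → j ℕ.≤ ListAction.sum (List.take j (toList k))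
      go zero    _  = z≤n
      go (suc j) j≤ with suc j ℕ.≟ n
      -- `InK` stops at n - 1; for j = n the partial sum is the total.
      ... | yes refl = ℕ.≤-reflexive (trans (sym total) (sym (sum-take-all k)))
      ... | no  j≢n  = partial (suc j) (s≤s z≤n) (ℕ.∸-monoˡ-≤ 1 (ℕ.≤∧≢⇒< j≤ j≢n))

  does-inK? : ∀ {n} (k : Vec ℕ n) → does (inK? k) ≡ good k 0
  does-inK? k = does-⇔ (mk⇔ (Ballot⇒good 0 k ∘ Equivalence.to (InK⇔Ballot k))
                            (Equivalence.from (InK⇔Ballot k) ∘ good⇒Ballot 0 k))
                       (inK? k) (T? (good k 0))

  -- Induction on the dimension for all advances e at once. A first exponent a contributes
  -- `dpow x a` times coefficient e + a of `0ℚ ∷ poly xs`: the prefixed zero matches the failure of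
  -- `goodAfter zero` and otherwise lowers the advance by one. Summing over a evaluates a tail,
  -- which is a coefficient of the shift. The bound b lets a range over all positions of the
  -- coefficient list.
  sumℚ-good : ∀ {n} b (x : Vec ℚ n) e → n ℕ.≤ b →
    sumℚ (List.map (λ k → if good k e then ∏ℚ (Vec.zipWith dpow x k) else 0ℚ) (boundedVecs b n)) ≡
    coefficient e (poly x)
  sumℚ-good b []       zero    _ = refl
  sumℚ-good b []       (suc e) _ = refl
  sumℚ-good {suc n} b (x ∷ xs) e n<b = begin
    sumℚ (List.map f (List.cartesianProductWith _∷_ (List.upTo (suc b)) ks))
      ≡⟨ sumℚ-boundedVecs f (List.upTo (suc b)) ks ⟩
    sumℚ (List.map (λ a → sumℚ (List.map (f ∘ (a ∷_)) ks)) (List.upTo (suc b)))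
      ≡⟨ cong sumℚ (List.map-cong first (List.upTo (suc b))) ⟩
    sumℚ (List.map (λ a → dpow x a * coefficient a (List.drop e p)) (List.upTo (suc b)))
      ≡⟨ cong sumℚ (List.map-upTo (λ a → dpow x a * coefficient a (List.drop e p)) (suc b)) ⟩
    sumℚ (List.applyUpTo (λ a → dpow x a * coefficient a (List.drop e p)) (suc b))
      ≡⟨ ev-sumℚ (dpow x) (List.drop e p) (suc b) short ⟩
    ev (dpow x) (List.drop e p)
      ≡⟨ coefficient-shift (dpow x) e p ⟨
    coefficient e (poly (x ∷ xs)) ∎
    where
    open ≡-Reasoning
    ks = boundedVecs b n
    p  = 0ℚ ∷ poly xs
    f : Vec ℕ (suc n) → ℚ
    f k = if good k e then ∏ℚ (Vec.zipWith dpow (x ∷ xs) k) else 0ℚ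
    if-* : ∀ (t : Bool) c q → (if t then c * q else 0ℚ) ≡ c * (if t then q else 0ℚ)
    if-* true  c q = refl
    if-* false c q = sym (ℚ.*-zeroʳ c)
    after : ∀ m → sumℚ (List.map (λ k → if goodAfter m k then ∏ℚ (Vec.zipWith dpow xs k) else 0ℚ) ks) ≡
                  coefficient m p
    after zero    = sumℚ-zero ks
    after (suc m) = sumℚ-good b xs m (ℕ.<⇒≤ n<b)
    first : ∀ a → sumℚ (List.map (f ∘ (a ∷_)) ks) ≡ dpow x a * coefficient a (List.drop e p)
    first a = trans (cong sumℚ (List.map-cong (λ k → if-* (goodAfter (e ℕ.+ a) k) (dpow x a) _) ks))
      (trans (sumℚ-*ˡ (dpow x a) _ ks)
        (cong (dpow x a *_) (trans (after (e ℕ.+ a)) (coefficient-+ e a p))))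
    short : List.length (List.drop e p) ℕ.≤ suc b
    short = ℕ.≤-trans (ℕ.≤-reflexive (List.length-drop e p))
      (ℕ.≤-trans (ℕ.m∸n≤m _ e) (ℕ.≤-trans (ℕ.≤-reflexive (cong suc (length-poly xs))) (s≤s n<b)))

  volume-0 : ∀ {n} (x : Vec ℚ n) → volume 0ℚ x ≡ coefficient 0 (poly x)
  volume-0 x = at-0 (poly x)
    where
    at-0 : ∀ p → ev (dpow 0ℚ) p ≡ coefficient 0 p
    at-0 []      = refl
    at-0 (c ∷ p) = trans (cong₂ _+_ (ℚ.*-identityˡ c) (ev-zero dpow-0-suc p)) (ℚ.+-identityʳ c)

  volumeSum : ∀ {n} → Vec ℚ n → ℚ
  volumeSum {n} x = sumℚ (List.map (λ k → ∏ℚ (Vec.zipWith dpow x k)) (K n))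

  volumeSum≡volume : ∀ {n} (x : Vec ℚ n) → volumeSum x ≡ volume 0ℚ x
  volumeSum≡volume {n} x = begin
    volumeSum x
      ≡⟨ sumℚ-filter inK? (λ k → ∏ℚ (Vec.zipWith dpow x k)) (boundedVecs n n) ⟩
    sumℚ (List.map (λ k → if does (inK? k) then ∏ℚ (Vec.zipWith dpow x k) else 0ℚ) (boundedVecs n n))
      ≡⟨ cong sumℚ (List.map-cong (λ k → cong (if_then ∏ℚ (Vec.zipWith dpow x k) else 0ℚ) (does-inK? k)) (boundedVecs n n)) ⟩
    sumℚ (List.map (λ k → if good k 0 then ∏ℚ (Vec.zipWith dpow x k) else 0ℚ) (boundedVecs n n))
      ≡⟨ sumℚ-good n x 0 ℕ.≤-refl ⟩
    coefficient 0 (poly x)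
      ≡⟨ volume-0 x ⟨
    volume 0ℚ x ∎
    where open ≡-Reasoning

  -- The multinomial form

  ∏recip! : ∀ {n} → Vec ℕ n → ℚ
  ∏recip! k = ∏ℚ (Vec.map recip! k)

  ∏recip!*∏! : ∀ {n} (k : Vec ℕ n) → ∏recip! k * fromℕℚ (∏! k) ≡ 1ℚ
  ∏recip!*∏! []      = refl
  ∏recip!*∏! (a ∷ k) = begin
    recip! a * ∏recip! k * fromℕℚ (a ! ℕ.* ∏! k)
      ≡⟨ cong (recip! a * ∏recip! k *_) (fromℕℚ-* (a !) (∏! k)) ⟩
    recip! a * ∏recip! k * (fromℕℚ (a !) * fromℕℚ (∏! k))
      ≡⟨ solve 4 (λ a b c d → a :* b :* (c :* d) := a :* c :* (b :* d)) refl (recip! a) (∏recip! k) (fromℕℚ (a !)) (fromℕℚ (∏! k)) ⟩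
    recip! a * fromℕℚ (a !) * (∏recip! k * fromℕℚ (∏! k))
      ≡⟨ cong₂ _*_ (recip!*! a) (∏recip!*∏! k) ⟩
    1ℚ ∎
    where open ≡-Reasoning

  ∏dpow : ∀ {n} (x : Vec ℚ n) k →
    ∏ℚ (Vec.zipWith dpow x k) ≡ ∏recip! k * ∏ℚ (Vec.zipWith _^ℚ_ x k)
  ∏dpow []       []      = refl
  ∏dpow (x ∷ xs) (a ∷ k) = trans (cong (dpow x a *_) (∏dpow xs k))
    (solve 4 (λ p r q s → p :* r :* (q :* s) := r :* q :* (p :* s)) refl
      (x ^ℚ a) (recip! a) (∏recip! k) _)

  -- The natural-number quotient is exact by `∏!∣sum!`. Inserting `q * P`, which is 1, restores the
  -- product `M * P`, that is n !, against which `r` cancels.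
  recip!*multinomial : ∀ {n m} (k : Vec ℕ m) → Vec.sum k ≡ n →
    recip! n * fromℕℚ (multinomial n k) ≡ ∏recip! k
  recip!*multinomial k refl = begin
    r * M                     ≡⟨ ℚ.*-identityʳ (r * M) ⟨
    r * M * 1ℚ                ≡⟨ cong (r * M *_) (∏recip!*∏! k) ⟨
    r * M * (q * P)           ≡⟨ solve 4 (λ r M q P → r :* M :* (q :* P) := q :* (r :* (M :* P))) refl r M q P ⟩
    q * (r * (M * P))         ≡⟨ cong (λ z → q * (r * z)) (fromℕℚ-* (multinomial n k) (∏! k)) ⟨
    q * (r * fromℕℚ (multinomial n k ℕ.* ∏! k))
      ≡⟨ cong (λ z → q * (r * fromℕℚ z)) (m/n*n≡m {{∏!≢0 k}} (∏!∣sum! k)) ⟩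
    q * (r * fromℕℚ (n !))    ≡⟨ cong (q *_) (recip!*! n) ⟩
    q * 1ℚ                    ≡⟨ ℚ.*-identityʳ q ⟩
    q                         ∎
    where
    open ≡-Reasoning
    n = Vec.sum k
    r = recip! n
    M = fromℕℚ (multinomial n k)
    P = fromℕℚ (∏! k)
    q = ∏recip! k

  volumeSum-multinomial : ∀ {n} (x : Vec ℚ n) → volumeSum x ≡
    recip! n * sumℚ (List.map (λ k → fromℕℚ (multinomial n k) * ∏ℚ (Vec.zipWith _^ℚ_ x k)) (K n))
  volumeSum-multinomial {n} x = trans
    (sumℚ-cong {as = K n} (All.tabulate λ {k} k∈ → trans (∏dpow x k)
      (trans (cong (_* ∏ℚ (Vec.zipWith _^ℚ_ x k))
               (sym (recip!*multinomial k (proj₂ (Equivalence.to (∈K⇔InK k) k∈)))))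
             (ℚ.*-assoc (recip! n) _ _))))
    (sumℚ-*ˡ (recip! n) _ (K n))

  -- Perturbation estimates

  -- M serves both as a bound for a and as a Lipschitz constant, which makes the
  -- condition closed under sums and products.
  record Near (M δ a a′ : ℚ) : Set where
    constructor near
    field
      nonneg  : 0ℚ ≤ a
      bounded : a ≤ M
      above   : a ≤ a′
      within  : a′ ≤ a + M * δ

  open Near

  module _ {δ : ℚ} (0≤δ : 0ℚ ≤ δ) (δ≤1 : δ ≤ 1ℚ) where

    near-const : ∀ {c} → 0ℚ ≤ c → Near c δ c c
    near-const {c} 0≤c = near 0≤c ℚ.≤-refl ℚ.≤-refl (≤-by (c * δ) (0≤* 0≤c 0≤δ) refl)

    near-+ : ∀ {M N a a′ b b′} → Near M δ a a′ → Near N δ b b′ → Near (M + N) δ (a + b) (a′ + b′)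
    near-+ {M} {N} {a} {a′} {b} {b′} x y = near
      (0≤+ (nonneg x) (nonneg y))
      (ℚ.+-mono-≤ (bounded x) (bounded y))
      (ℚ.+-mono-≤ (above x) (above y))
      (ℚ.≤-trans (ℚ.+-mono-≤ (within x) (within y)) (ℚ.≤-reflexive
        (solve 5 (λ a M d b N → a :+ M :* d :+ (b :+ N :* d) := a :+ b :+ (M :+ N) :* d) refl a M δ b N)))

    -- Of the three copies of `M * N`, two pay for the cross terms `a * N` and `M * b`, the third
    -- for `M * N * δ`, where δ ≤ 1 enters.
    near-* : ∀ {M N a a′ b b′} → Near M δ a a′ → Near N δ b b′ →
      Near (M * N + M * N + M * N) δ (a * b) (a′ * b′)
    near-* {M} {N} {a} {a′} {b} {b′} x y = near
      (0≤* (nonneg x) (nonneg y))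
      (ℚ.≤-trans (*-mono-≤ (nonneg x) (nonneg y) (bounded x) (bounded y))
        (≤-by (M * N + M * N) (0≤+ 0≤MN 0≤MN) (ℚ.+-comm (M * N + M * N) (M * N))))
      (*-mono-≤ (nonneg x) (nonneg y) (above x) (above y))
      (begin
        a′ * b′                       ≤⟨ *-mono-≤ (ℚ.≤-trans (nonneg x) (above x)) (ℚ.≤-trans (nonneg y) (above y)) (within x) (within y) ⟩
        (a + M * δ) * (b + N * δ)     ≡⟨ solve 5 (λ a M d b N → (a :+ M :* d) :* (b :+ N :* d) := a :* b :+ (a :* N :+ M :* b :+ M :* N :* d) :* d) refl a M δ b N ⟩
        a * b + (a * N + M * b + M * N * δ) * δ
          ≤⟨ ℚ.+-monoʳ-≤ (a * b) (*-monoʳ-≤ 0≤δ (ℚ.+-mono-≤ (ℚ.+-mono-≤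
               (*-monoʳ-≤ 0≤N (bounded x)) (*-monoˡ-≤ 0≤M (bounded y)))
               (ℚ.≤-trans (*-monoˡ-≤ 0≤MN δ≤1) (ℚ.≤-reflexive (ℚ.*-identityʳ (M * N)))))) ⟩
        a * b + (M * N + M * N + M * N) * δ ∎)
      where
      open ℚ.≤-Reasoning
      0≤M = ℚ.≤-trans (nonneg x) (bounded x)
      0≤N = ℚ.≤-trans (nonneg y) (bounded y)
      0≤MN = 0≤* 0≤M 0≤N

  -- The constant is fixed before δ and the points, because δ is later chosen small against it.
  near-^ : ∀ B a → ∃ λ M → ∀ {δ} → 0ℚ ≤ δ → δ ≤ 1ℚ → ∀ {t t′} → Near B δ t t′ → Near M δ (t ^ℚ a) (t′ ^ℚ a)
  near-^ B zero    = 1ℚ , λ 0≤δ δ≤1 _ → near-const 0≤δ δ≤1 0≤1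
  near-^ B (suc a) =
    let M , h = near-^ B a in
    B * M + B * M + B * M , λ 0≤δ δ≤1 {t} {t′} x →
      near-* 0≤δ δ≤1 {B} {M} {t} {t′} {t ^ℚ a} {t′ ^ℚ a} x (h 0≤δ δ≤1 x)

  near-dpow : ∀ B a → ∃ λ M → ∀ {δ} → 0ℚ ≤ δ → δ ≤ 1ℚ → ∀ {t t′} → Near B δ t t′ → Near M δ (dpow t a) (dpow t′ a)
  near-dpow B a =
    let M , h = near-^ B a
        r = recip! a
    in M * r + M * r + M * r , λ 0≤δ δ≤1 {t} {t′} x →
      near-* 0≤δ δ≤1 {M} {r} {t ^ℚ a} {t′ ^ℚ a} {r} {r} (h 0≤δ δ≤1 x) (near-const 0≤δ δ≤1 (0≤recip! a))

  near-∏ : ∀ {n} B (k : Vec ℕ n) → ∃ λ M → ∀ {δ} → 0ℚ ≤ δ → δ ≤ 1ℚ →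
    ∀ {x x′} → Pointwise (Near B δ) x x′ → Near M δ (∏ℚ (Vec.zipWith dpow x k)) (∏ℚ (Vec.zipWith dpow x′ k))
  near-∏ B []      = 1ℚ , λ { 0≤δ δ≤1 [] → near-const 0≤δ δ≤1 0≤1 }
  near-∏ B (a ∷ k) =
    let M , h = near-dpow B a
        N , hs = near-∏ B k
    in M * N + M * N + M * N , λ { 0≤δ δ≤1 {t ∷ ts} {t′ ∷ ts′} (x ∷ xs) →
      near-* 0≤δ δ≤1 {M} {N} {dpow t a} {dpow t′ a}
        {∏ℚ (Vec.zipWith dpow ts k)} {∏ℚ (Vec.zipWith dpow ts′ k)}
        (h 0≤δ δ≤1 x) (hs 0≤δ δ≤1 xs) }

  near-sum : ∀ {n} B (ks : List (Vec ℕ n)) → ∃ λ M → ∀ {δ} → 0ℚ ≤ δ → δ ≤ 1ℚ →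
    ∀ {x x′} → Pointwise (Near B δ) x x′ →
    Near M δ (sumℚ (List.map (λ k → ∏ℚ (Vec.zipWith dpow x k)) ks))
             (sumℚ (List.map (λ k → ∏ℚ (Vec.zipWith dpow x′ k)) ks))
  near-sum B []       = 0ℚ , λ 0≤δ δ≤1 _ → near-const 0≤δ δ≤1 ℚ.≤-refl
  near-sum B (k ∷ ks) =
    let M , h = near-∏ B k
        N , hs = near-sum B ks
    in M + N , λ 0≤δ δ≤1 {x} {x′} c →
      near-+ 0≤δ δ≤1 {M} {N}
        {∏ℚ (Vec.zipWith dpow x k)} {∏ℚ (Vec.zipWith dpow x′ k)}
        {sumℚ (List.map (λ k → ∏ℚ (Vec.zipWith dpow x k)) ks)}
        {sumℚ (List.map (λ k → ∏ℚ (Vec.zipWith dpow x′ k)) ks)}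
        (h 0≤δ δ≤1 c) (hs 0≤δ δ≤1 c)

  -- Real points are only known to within δ, so outer boxes are enlarged by δ on every side.
  thicken : ∀ {δ} → 0ℚ ≤ δ → Interval → Interval
  thicken {δ} 0≤δ i = [ lo i - δ , hi i + δ ∣ ℚ.≤-trans {j = lo i}
    (≤-by δ 0≤δ (solve 2 (λ a d → a := a :- d :+ d) refl (lo i) δ))
    (ℚ.≤-trans (lo≤hi i) (≤-by δ 0≤δ refl)) ]

  -- Both ends move by δ, so the width grows by 2 δ; the summand 2 of the constant accounts for
  -- this.
  near-width : ∀ i {δ} (0≤δ : 0ℚ ≤ δ) → Near (width i + (1ℚ + 1ℚ)) δ (width i) (width (thicken 0≤δ i))
  near-width i {δ} 0≤δ = near 0≤w (≤-by {p = w} (1ℚ + 1ℚ) (0≤+ 0≤1 0≤1) refl)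
    (≤-by {p = w} (δ + δ) (0≤+ 0≤δ 0≤δ)
      (solve 3 (λ h l d → h :+ d :- (l :- d) := h :- l :+ (d :+ d)) refl (hi i) (lo i) δ))
    (≤-by {p = hi i + δ - (lo i - δ)} (w * δ) (0≤* {p = w} 0≤w 0≤δ)
      (solve 3 (λ h l d → h :- l :+ (h :- l :+ (con 1ℚ :+ con 1ℚ)) :* d := h :+ d :- (l :- d) :+ (h :- l) :* d) refl (hi i) (lo i) δ))
    where
    w = width i
    0≤w : 0ℚ ≤ w
    0≤w = 0≤-difference (lo≤hi i)

  near-content : ∀ {n} (b : IntervalBox n) → ∃ λ M → ∀ {δ} (0≤δ : 0ℚ ≤ δ) → δ ≤ 1ℚ →
    Near M δ (content b) (content (Vec.map (thicken 0≤δ) b))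
  near-content []      = 1ℚ , λ 0≤δ δ≤1 → near-const 0≤δ δ≤1 0≤1
  near-content (i ∷ b) =
    let M = width i + (1ℚ + 1ℚ)
        N , hs = near-content b
    in M * N + M * N + M * N , λ 0≤δ δ≤1 →
      near-* 0≤δ δ≤1 {M} {N} {width i} {width (thicken 0≤δ i)} {content b} {content (Vec.map (thicken 0≤δ) b)}
        (near-width i 0≤δ) (hs 0≤δ δ≤1)

  near-totalContent : ∀ {n} (bs : List (IntervalBox n)) → ∃ λ M → ∀ {δ} (0≤δ : 0ℚ ≤ δ) → δ ≤ 1ℚ →
    Near M δ (totalContent bs) (totalContent (List.map (Vec.map (thicken 0≤δ)) bs))
  near-totalContent []       = 0ℚ , λ 0≤δ δ≤1 → near-const 0≤δ δ≤1 ℚ.≤-refl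
  near-totalContent (b ∷ bs) =
    let M , h = near-content b
        N , hs = near-totalContent bs
    in M + N , λ 0≤δ δ≤1 →
      near-+ 0≤δ δ≤1 {M} {N} {content b} {content (Vec.map (thicken 0≤δ) b)}
        {totalContent bs} {totalContent (List.map (Vec.map (thicken 0≤δ)) bs)}
        (h 0≤δ δ≤1) (hs 0≤δ δ≤1)

  -- Partial sums and the recursive description of the region

  partialSum : ∀ {n} → ℕ → Vec ℚ n → ℚ
  partialSum i q = sumℚ (List.take i (toList q))

  partialSum-mono : ∀ {n} i {p q : Vec ℚ n} → Pointwise _≤_ p q → partialSum i p ≤ partialSum i q
  partialSum-mono zero    _          = ℚ.≤-refl
  partialSum-mono (suc i) []         = ℚ.≤-refl
  partialSum-mono (suc i) (le ∷ les) = ℚ.+-mono-≤ le (partialSum-mono i les)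

  partialSum-map-+ : ∀ {n} {A : Set} (f : A → ℚ) δ i (v : Vec A n) → i ℕ.≤ n →
    partialSum i (Vec.map (λ a → f a + δ) v) ≡ partialSum i (Vec.map f v) + steps δ i
  partialSum-map-+ f δ zero    v       _       = refl
  partialSum-map-+ f δ (suc i) (a ∷ v) (s≤s le) =
    trans (cong (f a + δ +_) (partialSum-map-+ f δ i v le))
      (solve 4 (λ a d s t → a :+ d :+ (s :+ t) := a :+ s :+ (t :+ d)) refl (f a) δ _ (steps δ i))

  partialSums⇒InRegion : ∀ {n} s (xs qs : Vec ℚ n) → VecAll.All (0ℚ ≤_) qs →
    (∀ i → 1 ℕ.≤ i → i ℕ.≤ n → partialSum i qs ≤ s + partialSum i xs) → InRegion s xs qs
  partialSums⇒InRegion s []       []       _                   _ = tt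
  partialSums⇒InRegion s (x ∷ xs) (q ∷ qs) (0≤q VecAll.∷ 0≤qs) h =
    0≤q
    , subst₂ _≤_ (ℚ.+-identityʳ q) (cong (s +_) (ℚ.+-identityʳ x)) (h 1 (s≤s z≤n) (s≤s z≤n))
    , partialSums⇒InRegion (s + x - q) xs qs 0≤qs λ i _ i≤n →
        subst₂ _≤_ (solve 2 (λ q S → q :+ S :- q := S) refl q (partialSum i qs))
                   (solve 4 (λ s x q S → s :+ (x :+ S) :- q := s :+ x :- q :+ S) refl s x q (partialSum i xs))
          (ℚ.+-monoˡ-≤ (- q) (h (suc i) (s≤s z≤n) (s≤s i≤n)))

  Inside⇒partialSums : ∀ {n s} (xs : Vec ℚ n) b → Inside s xs b →
    ∀ i → 1 ℕ.≤ i → i ℕ.≤ n → partialSum i (Vec.map hi b) ≤ s + partialSum i xs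
  Inside⇒partialSums {s = s} (x ∷ xs) (j ∷ b) (_ , hi≤ , _) (suc zero) _ _ =
    subst₂ _≤_ (sym (ℚ.+-identityʳ (hi j))) (cong (s +_) (sym (ℚ.+-identityʳ x))) hi≤
  Inside⇒partialSums {s = s} (x ∷ xs) (j ∷ b) (_ , _ , ins) (suc i@(suc _)) _ (s≤s i≤n) =
    ℚ.≤-trans (ℚ.+-monoʳ-≤ (hi j) (Inside⇒partialSums xs b ins i (s≤s z≤n) i≤n))
      (ℚ.≤-reflexive (solve 4 (λ h s x S → h :+ (s :+ x :- h :+ S) := s :+ (x :+ S)) refl (hi j) s x (partialSum i xs)))

  -- Passing to Cauchy sequences

  Eventually : (ℕ → Set) → Set
  Eventually P = ∃ λ N → ∀ m → N ℕ.≤ m → P m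

  eventually-× : ∀ {P Q : ℕ → Set} → Eventually P → Eventually Q → Eventually (λ m → P m × Q m)
  eventually-× (M , p) (N , q) = M ℕ.⊔ N , λ m m≥ →
    p m (ℕ.m⊔n≤o⇒m≤o M N m≥) , q m (ℕ.m⊔n≤o⇒n≤o M N m≥)

  eventually-map : ∀ {P Q : ℕ → Set} → (∀ {m} → P m → Q m) → Eventually P → Eventually Q
  eventually-map f (N , p) = N , λ m m≥ → f (p m m≥)

  eventually-All : ∀ {A : Set} {n} {P : A → ℕ → Set} (v : Vec A n) →
    (∀ i → Eventually (P (lookup v i))) → Eventually (λ m → VecAll.All (λ a → P a m) v)
  eventually-All []      h = 0 , λ _ _ → VecAll.[]
  eventually-All (a ∷ v) h =
    eventually-map (λ (p , ps) → p VecAll.∷ ps) (eventually-× (h Fin.zero) (eventually-All v (h ∘ Fin.suc)))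

  eventually-range : ∀ {P : ℕ → ℕ → Set} n → (∀ i → 1 ℕ.≤ i → i ℕ.≤ n → Eventually (P i)) →
    Eventually (λ m → ∀ i → 1 ℕ.≤ i → i ℕ.≤ n → P i m)
  eventually-range zero    h = 0 , λ { _ _ (suc _) _ () }
  eventually-range {P} (suc n) h = eventually-map combine
    (eventually-× (h (suc n) (s≤s z≤n) ℕ.≤-refl)
                  (eventually-range n (λ i i≥1 i≤n → h i i≥1 (ℕ.m≤n⇒m≤1+n i≤n))))
    where
    combine : ∀ {m} → P (suc n) m × (∀ i → 1 ℕ.≤ i → i ℕ.≤ n → P i m) → ∀ i → 1 ℕ.≤ i → i ℕ.≤ suc n → P i m
    combine (last , init) i i≥1 i≤ with i ℕ.≟ suc n
    ... | yes refl = last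
    ... | no  i≢   = init i i≥1 (ℕ.s≤s⁻¹ (ℕ.≤∧≢⇒< i≤ i≢))

  p≤∣p∣ : ∀ p → p ≤ ℚ.∣ p ∣
  p≤∣p∣ p with ℚ.≤-total 0ℚ p
  ... | inj₁ 0≤p = ℚ.≤-reflexive (sym (ℚ.0≤p⇒∣p∣≡p 0≤p))
  ... | inj₂ p≤0 = ℚ.≤-trans p≤0 (ℚ.0≤∣p∣ p)

  ∣-∣<⇒≤ : ∀ p q {κ} → ℚ.∣ p - q ∣ < κ → p ≤ q + κ
  ∣-∣<⇒≤ p q {κ} h = ℚ.<⇒≤ (subst (_< q + κ) (solve 2 (λ p q → q :+ (p :- q) := p) refl p q)
    (ℚ.+-monoʳ-< q (ℚ.≤-<-trans (p≤∣p∣ (p - q)) h)))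

  Close : ℚ → ℝ → ℕ → ℕ → Set
  Close κ r N m = seq r m ≤ seq r N + κ × seq r N ≤ seq r m + κ

  -- Every late index N serves as a centre, not just one, so the condition can be combined with
  -- other eventual conditions at a common index.
  eventually-Close : ∀ {n} (x : Vec ℝ n) {κ} → 0ℚ < κ →
    Eventually (λ N → ∀ m → N ℕ.≤ m → VecAll.All (λ r → Close κ r N m) x)
  eventually-Close x {κ} 0<κ =
    let N , h = eventually-All {P = λ r N → ∀ m → N ℕ.≤ m → Close κ r N m} x (λ i → settles (lookup x i))
    in N , λ M M≥N m m≥M → VecAll.map (λ c → c m m≥M) (h M M≥N)
    where
    settles : ∀ r → Eventually (λ N → ∀ m → N ℕ.≤ m → Close κ r N m)
    settles r = let N , h = cauchy r κ 0<κ in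
      N , λ M M≥N m m≥M → let m≥N = ℕ.≤-trans M≥N m≥M in
        ∣-∣<⇒≤ (seq r m) (seq r M) (h m M m≥N M≥N) , ∣-∣<⇒≤ (seq r M) (seq r m) (h M m M≥N m≥N)

  _⊓⁺_ : ∃ (0ℚ <_) → ∃ (0ℚ <_) → ∃ (0ℚ <_)
  (p , 0<p) ⊓⁺ (q , 0<q) with ℚ.≤-total p q
  ... | inj₁ _ = p , 0<p
  ... | inj₂ _ = q , 0<q

  ⊓⁺≤ˡ : ∀ p q → proj₁ (p ⊓⁺ q) ≤ proj₁ p
  ⊓⁺≤ˡ (p , _) (q , _) with ℚ.≤-total p q
  ... | inj₁ _   = ℚ.≤-refl
  ... | inj₂ q≤p = q≤p

  ⊓⁺≤ʳ : ∀ p q → proj₁ (p ⊓⁺ q) ≤ proj₁ q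
  ⊓⁺≤ʳ (p , _) (q , _) with ℚ.≤-total p q
  ... | inj₁ p≤q = p≤q
  ... | inj₂ _   = ℚ.≤-refl

  positiveLowerBound : ∀ {n} (x : Vec ℝ n) → (∀ i → 0ℝ R.< lookup x i) →
    ∃ λ c → 0ℚ < c × Eventually (λ m → VecAll.All (λ r → c ≤ seq r m) x)
  positiveLowerBound []      _ = 1ℚ , 0<1 , 0 , λ _ _ → VecAll.[]
  positiveLowerBound (r ∷ x) h =
    let c , 0<c , ev₁ = h Fin.zero
        d , 0<d , ev₂ = positiveLowerBound x (h ∘ Fin.suc)
        m , 0<m = (c , 0<c) ⊓⁺ (d , 0<d)
    in m , 0<m , eventually-map
      (λ (p , ps) → ℚ.≤-trans (⊓⁺≤ˡ (c , 0<c) (d , 0<d)) (ℚ.≤-trans (ℚ.≤-reflexive (sym (ℚ.+-identityˡ c))) p)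
        VecAll.∷ VecAll.map (ℚ.≤-trans (⊓⁺≤ʳ (c , 0<c) (d , 0<d))) ps)
      (eventually-× ev₁ ev₂)

  upperBound : ∀ {n} (x : Vec ℝ n) →
    ∃ λ B → 0ℚ ≤ B × Eventually (λ m → VecAll.All (λ r → seq r m ≤ B) x)
  upperBound []      = 0ℚ , ℚ.≤-refl , 0 , λ _ _ → VecAll.[]
  upperBound (r ∷ x) =
    let B , 0<B , N , h = cauchy-bounded (seq r) (cauchy r)
        C , 0≤C , ev₂ = upperBound x
    in B + C , 0≤+ (ℚ.<⇒≤ 0<B) 0≤C , eventually-map
      (λ (p , ps) → ℚ.≤-trans p (≤-by {p = B} C 0≤C refl)
        VecAll.∷ VecAll.map (λ le → ℚ.≤-trans le (≤-by {p = C} B (ℚ.<⇒≤ 0<B) (ℚ.+-comm B C))) ps)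
      (eventually-× (N , λ m m≥ → ℚ.≤-trans (p≤∣p∣ (seq r m)) (h m m≥)) ev₂)

  -- Evaluating real expressions at an index

  _at_ : ∀ {n} → Vec ℝ n → ℕ → Vec ℚ n
  x at m = Vec.map (λ r → seq r m) x

  seq-^ : ∀ r k m → seq (r R.^ k) m ≡ seq r m ^ℚ k
  seq-^ r zero    m = refl
  seq-^ r (suc k) m = cong (seq r m *_) (seq-^ r k m)

  seq-∏ : ∀ {n} {f : ℝ → ℕ → ℝ} {g : ℚ → ℕ → ℚ} m → (∀ r a → seq (f r a) m ≡ g (seq r m) a) →
    ∀ (x : Vec ℝ n) k → seq (R.∏ (Vec.zipWith f x k)) m ≡ ∏ℚ (Vec.zipWith g (x at m) k)
  seq-∏ m e []      []      = refl
  seq-∏ m e (r ∷ x) (a ∷ k) = cong₂ _*_ (e r a) (seq-∏ m e x k)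

  seq-sum : ∀ {A : Set} {f : A → ℝ} {g : A → ℚ} m → (∀ a → seq (f a) m ≡ g a) →
    ∀ as → seq (R.sumℝ (List.map f as)) m ≡ sumℚ (List.map g as)
  seq-sum m e []       = refl
  seq-sum m e (a ∷ as) = cong₂ _+_ (e a) (seq-sum m e as)

  seq-partialSum : ∀ {n} m i (y : Vec ℝ n) → seq (R.sumℝ (List.take i (toList y))) m ≡ partialSum i (y at m)
  seq-partialSum m zero    y       = refl
  seq-partialSum m (suc i) []      = refl
  seq-partialSum m (suc i) (r ∷ y) = cong (seq r m +_) (seq-partialSum m i y)

  volumeSumℝ : ∀ {n} → Vec ℝ n → ℝ
  volumeSumℝ {n} x = R.sumℝ (List.map (λ k → R.∏ (Vec.zipWith (λ xᵢ kᵢ → xᵢ R.^ kᵢ R.* R.1/ kᵢ !) x k)) (K n))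

  seq-volumeSumℝ : ∀ {n} (x : Vec ℝ n) m → seq (volumeSumℝ x) m ≡ volumeSum (x at m)
  seq-volumeSumℝ {n} x m = seq-sum m (seq-∏ m (λ r a → cong (_* recip! a) (seq-^ r a m)) x) (K n)

  seq-multinomialSum : ∀ {n} (x : Vec ℝ n) m →
    seq (R.1/ n ! R.* R.sumℝ (List.map (λ k → R.fromℕ (multinomial n k) R.* R.∏ (Vec.zipWith R._^_ x k)) (K n))) m ≡
    recip! n * sumℚ (List.map (λ k → fromℕℚ (multinomial n k) * ∏ℚ (Vec.zipWith _^ℚ_ (x at m) k)) (K n))
  seq-multinomialSum {n} x m = cong (recip! n *_)
    (seq-sum m (λ k → cong (fromℕℚ (multinomial n k) *_) (seq-∏ m (λ r a → seq-^ r a m) x k)) (K n))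

  seq-≡⇒≃ : ∀ {r s} → (∀ m → seq r m ≡ seq s m) → r R.≃ s
  seq-≡⇒≃ {r} {s} e ε 0<ε = 0 , λ m _ →
    subst (λ t → ℚ.∣ t ∣ < ε) (sym (trans (cong (_- seq s m) (e m)) (ℚ.+-inverseʳ (seq s m)))) 0<ε

  seq-≤⇒≤ : ∀ r s → Eventually (λ m → seq r m ≤ seq s m) → r R.≤ s
  seq-≤⇒≤ r s (N , h) ε 0<ε = N , λ m m≥ → ℚ.≤-trans (h m m≥) (≤-by {p = seq s m} ε (ℚ.<⇒≤ 0<ε) refl)

  -- Rational boxes as real boxes

  toBox : ∀ {n} → IntervalBox n → Box n
  toBox b = record
    { lower       = Vec.map (fromℚ ∘ lo) b
    ; upper       = Vec.map (fromℚ ∘ hi) b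
    ; lower≤upper = ordered b
    }
    where
    ordered : ∀ {n} (b : IntervalBox n) i →
      lookup (Vec.map (fromℚ ∘ lo) b) i R.≤ lookup (Vec.map (fromℚ ∘ hi) b) i
    ordered (j ∷ b) Fin.zero    = seq-≤⇒≤ (fromℚ (lo j)) (fromℚ (hi j)) (0 , λ _ _ → lo≤hi j)
    ordered (j ∷ b) (Fin.suc i) = ordered b i

  seq-totalVolume : ∀ {n} (bs : List (IntervalBox n)) m →
    seq (R.totalVolume (List.map toBox bs)) m ≡ totalContent bs
  seq-totalVolume []       m = refl
  seq-totalVolume (b ∷ bs) m = cong₂ _+_ (seq-boxVolume b) (seq-totalVolume bs m)
    where
    seq-boxVolume : ∀ {n} (b : IntervalBox n) → seq (R.boxVolume (toBox b)) m ≡ content b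
    seq-boxVolume []      = refl
    seq-boxVolume (i ∷ b) = cong (width i *_) (seq-boxVolume b)

  -- The strict inequality provides a fixed gap ε, while the weak one, instantiated at ε / 2, gives
  -- back only half of it.
  ≤-<-absurd : ∀ p q r → q ≤ p → fromℚ p R.≤ r → r R.< fromℚ q → ⊥
  ≤-<-absurd p q r q≤p p≤r (ε , 0<ε , M , r<q) =
    let L , p≤ = p≤r (½ * ε) (half 0<ε)
        N = L ℕ.⊔ M
    in gap N (p≤ N (ℕ.m≤m⊔n L M)) (r<q N (ℕ.m≤n⊔m L M))
    where
    open ℚ.≤-Reasoning
    gap : ∀ N → p ≤ seq r N + ½ * ε → seq r N + ε ≤ q → ⊥
    gap N p≤ ≤q = ℚ.<-irrefl refl (begin-strict
      p                            ≤⟨ p≤ ⟩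
      seq r N + ½ * ε              ≡⟨ ℚ.+-identityʳ (seq r N + ½ * ε) ⟨
      seq r N + ½ * ε + 0ℚ         <⟨ ℚ.+-monoʳ-< (seq r N + ½ * ε) (half 0<ε) ⟩
      seq r N + ½ * ε + ½ * ε      ≡⟨ ℚ.+-assoc (seq r N) (½ * ε) (½ * ε) ⟩
      seq r N + (½ * ε + ½ * ε)    ≡⟨ cong (seq r N +_) (half+half ε) ⟩
      seq r N + ε                  ≤⟨ ≤q ⟩
      q                            ≤⟨ q≤p ⟩
      p                            ∎)

  Separated⇒Disjoint : ∀ {n} (b c : IntervalBox n) → Separated b c → R.Disjoint (toBox b) (toBox c)
  Separated⇒Disjoint [] [] ()
  Separated⇒Disjoint (i ∷ b) (j ∷ c) (inj₁ (inj₁ le)) (r ∷ y) (y∈b , y∈c) =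
    ≤-<-absurd (lo j) (hi i) r le (proj₁ (y∈c Fin.zero)) (proj₂ (y∈b Fin.zero))
  Separated⇒Disjoint (i ∷ b) (j ∷ c) (inj₁ (inj₂ le)) (r ∷ y) (y∈b , y∈c) =
    ≤-<-absurd (lo i) (hi j) r le (proj₁ (y∈b Fin.zero)) (proj₂ (y∈c Fin.zero))
  Separated⇒Disjoint (i ∷ b) (j ∷ c) (inj₂ sep) (r ∷ y) (y∈b , y∈c) =
    Separated⇒Disjoint b c sep y (y∈b ∘ Fin.suc , y∈c ∘ Fin.suc)

  pointwise-map : ∀ {A : Set} {n} {R : ℚ → ℚ → Set} {f g : A → ℚ} {v : Vec A n} →
    VecAll.All (λ a → R (f a) (g a)) v → Pointwise R (Vec.map f v) (Vec.map g v)
  pointwise-map VecAll.[]       = []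
  pointwise-map (e VecAll.∷ es) = e ∷ pointwise-map es

  eventually-≤-hi : ∀ {n} (y : Vec ℝ n) b → y R.∈ᵇ toBox b →
    Eventually (λ m → Pointwise _≤_ (y at m) (Vec.map hi b))
  eventually-≤-hi []      []      _  = 0 , λ _ _ → []
  eventually-≤-hi (r ∷ y) (i ∷ b) y∈ =
    let _ , ε , 0<ε , r< = y∈ Fin.zero in
    eventually-map (λ {m} (le , les) → ℚ.≤-trans (≤-by {p = seq r m} ε (ℚ.<⇒≤ 0<ε) refl) le ∷ les)
    (eventually-× r< (eventually-≤-hi y b (y∈ ∘ Fin.suc)))

  Inside⇒0≤ : ∀ {n s} (xs : Vec ℚ n) b → Inside s xs b → ∀ y → y R.∈ᵇ toBox b → ∀ i → 0ℝ R.≤ lookup y i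
  Inside⇒0≤ (x ∷ xs) (j ∷ b) (0≤lo , _ , _) (r ∷ y) y∈ Fin.zero ε 0<ε =
    eventually-map (ℚ.≤-trans 0≤lo) (proj₁ (y∈ Fin.zero) ε 0<ε)
  Inside⇒0≤ (x ∷ xs) (j ∷ b) (_ , _ , ins) (r ∷ y) y∈ (Fin.suc i) =
    Inside⇒0≤ xs b ins y (y∈ ∘ Fin.suc) i

  Inside⇒Π : ∀ {n} (x : Vec ℝ n) q b → Eventually (λ m → Pointwise _≤_ q (x at m)) →
    Inside 0ℚ q b → ∀ y → y R.∈ᵇ toBox b → Π x y
  Inside⇒Π x q b q≤x ins y y∈ = Inside⇒0≤ q b ins y y∈ , λ i i≥1 i≤n →
    seq-≤⇒≤ (R.sumℝ (List.take i (toList y))) (R.sumℝ (List.take i (toList x))) (eventually-map (λ {m} (y≤ , q≤) → subst₂ _≤_ (sym (seq-partialSum m i y)) (sym (seq-partialSum m i x)) (begin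
      partialSum i (y at m)              ≤⟨ partialSum-mono i y≤ ⟩
      partialSum i (Vec.map hi b)        ≤⟨ Inside⇒partialSums q b ins i i≥1 i≤n ⟩
      0ℚ + partialSum i q                ≡⟨ ℚ.+-identityˡ _ ⟩
      partialSum i q                     ≤⟨ partialSum-mono i q≤ ⟩
      partialSum i (x at m)              ∎))
    (eventually-× (eventually-≤-hi y b y∈) q≤x))
    where open ℚ.≤-Reasoning

  -- The rounded coordinate is z = `seq r N + η`, and all later terms lie in [z - 2 η , z].
  -- Enlarging by δ ≥ 2 η covers the lower end and leaves δ as the margin for strictness at the
  -- upper end.
  InBox⇒∈ᵇ : ∀ {n} {δ η} (0≤δ : 0ℚ ≤ δ) → 0ℚ < δ → η + η ≤ δ → ∀ N (y : Vec ℝ n) b →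
    (∀ m → N ℕ.≤ m → VecAll.All (λ r → Close η r N m) y) →
    InBox (Vec.map (λ r → seq r N + η) y) b → y R.∈ᵇ toBox (Vec.map (thicken 0≤δ) b)
  InBox⇒∈ᵇ {δ = δ} {η} 0≤δ 0<δ ηη≤δ N (r ∷ y) (i ∷ b) close (lo≤ , <hi , z∈) Fin.zero =
    seq-≤⇒≤ (fromℚ (lo i - δ)) r (N , λ m m≥ → begin
      lo i - δ                    ≤⟨ ℚ.+-mono-≤ lo≤ (ℚ.neg-antimono-≤ ηη≤δ) ⟩
      seq r N + η - (η + η)       ≡⟨ solve 2 (λ a e → a :+ e :- (e :+ e) := a :- e) refl (seq r N) η ⟩
      seq r N - η                 ≤⟨ ℚ.+-monoˡ-≤ (- η) (proj₂ (VecAll.head (close m m≥))) ⟩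
      seq r m + η - η             ≡⟨ solve 2 (λ a e → a :+ e :- e := a) refl (seq r m) η ⟩
      seq r m                     ∎)
    , δ , 0<δ , N , λ m m≥ → ℚ.+-monoˡ-≤ δ (ℚ.≤-trans (proj₁ (VecAll.head (close m m≥))) (ℚ.<⇒≤ <hi))
    where open ℚ.≤-Reasoning
  InBox⇒∈ᵇ 0≤δ 0<δ ηη≤δ N (r ∷ y) (i ∷ b) close (_ , _ , z∈) (Fin.suc j) =
    InBox⇒∈ᵇ 0≤δ 0<δ ηη≤δ N y b (λ m m≥ → VecAll.tail (close m m≥)) z∈ j

  ∣∣-factor : ∀ M {e} → 0ℚ < e → ∃ λ δ → 0ℚ < δ × (∀ {δ′} → 0ℚ ≤ δ′ → δ′ ≤ δ → M * δ′ ≤ e)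
  ∣∣-factor M {e} 0<e =
    let δ , 0<δ , le = small-factor (ℚ.0≤∣p∣ M) 0<e
    in δ , 0<δ , λ {δ′} 0≤δ′ δ′≤δ → ℚ.≤-trans (*-monoʳ-≤ {p = M} {q = ℚ.∣ M ∣} 0≤δ′ (p≤∣p∣ M))
         (ℚ.≤-trans (*-monoˡ-≤ {p = δ′} {q = δ} {r = ℚ.∣ M ∣} (ℚ.0≤∣p∣ M) δ′≤δ) le)

  quarters : ∀ δ → ½ * (½ * δ) + ½ * (½ * δ) + (½ * (½ * δ) + ½ * (½ * δ)) ≡ δ
  quarters δ = trans (cong₂ _+_ (half+half (½ * δ)) (half+half (½ * δ))) (half+half δ)

  steps-+ : ∀ g h i → steps (g + h) i ≡ steps g i + steps h i
  steps-+ g h zero    = refl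
  steps-+ g h (suc i) = trans (cong (_+ (g + h)) (steps-+ g h i))
    (solve 4 (λ a b g h → a :+ b :+ (g :+ h) := a :+ g :+ (b :+ h)) refl (steps g i) (steps h i) g h)

  steps-mono : ∀ {g h} → g ≤ h → ∀ i → steps g i ≤ steps h i
  steps-mono g≤h zero    = ℚ.≤-refl
  steps-mono g≤h (suc i) = ℚ.+-mono-≤ (steps-mono g≤h i) g≤h

  ≤steps : ∀ {h} → 0ℚ ≤ h → ∀ i → 1 ℕ.≤ i → h ≤ steps h i
  ≤steps {h} 0≤h (suc i) _ = ≤-by {p = h} (steps h i) (0≤steps 0≤h i) (ℚ.+-comm (steps h i) h)

  -- The rounding budget for i coordinates: i κ for moving x to the index N, η for the real
  -- inequality, i η for rounding y upwards. Since i ≥ 1, each is at most i κ, within i δ = 4 i κ.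
  steps-slack : ∀ {κ η δ} → 0ℚ ≤ κ → η ≤ κ → κ + κ + (κ + κ) ≡ δ → ∀ i → 1 ℕ.≤ i →
    steps κ i + η + steps η i ≤ steps δ i
  steps-slack {κ} {η} 0≤κ η≤κ refl i i≥1 = begin
    S + η + steps η i        ≤⟨ ℚ.+-mono-≤ (ℚ.+-monoʳ-≤ S (ℚ.≤-trans η≤κ (≤steps 0≤κ i i≥1))) (steps-mono η≤κ i) ⟩
    S + S + S                ≤⟨ ≤-by {p = S + S + S} S (0≤steps 0≤κ i) (sym (ℚ.+-assoc (S + S) S S)) ⟩
    S + S + (S + S)          ≡⟨ cong₂ _+_ (steps-+ κ κ i) (steps-+ κ κ i) ⟨
    steps (κ + κ) i + steps (κ + κ) i ≡⟨ steps-+ (κ + κ) (κ + κ) i ⟨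
    steps (κ + κ + (κ + κ)) i ∎
    where
    open ℚ.≤-Reasoning
    S = steps κ i

  -- Squeezing x between rational vectors

  -- κ bounds the fluctuation of x after N, and δ is the displacement of the rational vectors. The
  -- factor four leaves room in `x⁺` for rounded points of Π.
  record Approximation {n} (x : Vec ℝ n) (e : ℚ) : Set where
    field
      N     : ℕ
      κ δ   : ℚ
      0<κ   : 0ℚ < κ
      4κ≡δ  : κ + κ + (κ + κ) ≡ δ
      close : ∀ m → N ℕ.≤ m → VecAll.All (λ r → Close κ r N m) x

    x⁻ : Vec ℚ n
    x⁻ = Vec.map (λ r → seq r N - δ) x

    x⁺ : Vec ℚ n
    x⁺ = Vec.map (λ r → seq r N + δ) x

    field
      0<x⁻    : VecAll.All (0ℚ <_) x⁻
      0<x⁺    : VecAll.All (0ℚ <_) x⁺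
      x⁻≤x    : ∀ m → N ℕ.≤ m → Pointwise _≤_ x⁻ (x at m)
      volume⁻ : ∀ m → N ℕ.≤ m → volumeSum (x at m) ≤ volumeSum x⁻ + e
      volume⁺ : ∀ m → N ℕ.≤ m → volumeSum x⁺ ≤ volumeSum (x at m) + e

  module _ {B c κ δ : ℚ} (0≤B : 0ℚ ≤ B) (0<c : 0ℚ < c) (0≤δ : 0ℚ ≤ δ) (κ≤δ : κ ≤ δ) (δ≤½c : δ ≤ ½ * c)
    {r N m} (c≤rN : c ≤ seq r N) (rN≤B : seq r N ≤ B) (c≤rm : c ≤ seq r m) (rm≤B : seq r m ≤ B)
    (close : Close κ r N m) where

    open ℚ.≤-Reasoning

    private
      a = seq r N
      b = seq r m
      -- One constant for both roles in `Near`: B bounds the values, and 2 δ bounds both gaps, from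
      -- a - δ to b and from b to a + δ.
      C = B + (1ℚ + 1ℚ)

      b≤a+δ : b ≤ a + δ
      b≤a+δ = ℚ.≤-trans (proj₁ close) (ℚ.+-monoʳ-≤ a κ≤δ)

      a≤b+δ : a ≤ b + δ
      a≤b+δ = ℚ.≤-trans (proj₂ close) (ℚ.+-monoʳ-≤ b κ≤δ)

      B≤C : B ≤ C
      B≤C = ≤-by {p = B} (1ℚ + 1ℚ) (0≤+ 0≤1 0≤1) refl

      +δδ≤+Cδ : ∀ t → t + (δ + δ) ≤ t + C * δ
      +δδ≤+Cδ t = ≤-by {p = t + (δ + δ)} (B * δ) (0≤* {p = B} 0≤B 0≤δ)
        (solve 3 (λ t B d → t :+ (B :+ (con 1ℚ :+ con 1ℚ)) :* d := t :+ (d :+ d) :+ B :* d) refl t B δ)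

    0<x-δ : 0ℚ < a - δ
    0<x-δ = begin-strict
      0ℚ                        <⟨ half 0<c ⟩
      ½ * c                     ≡⟨ solve 1 (λ h → h := h :+ h :- h) refl (½ * c) ⟩
      ½ * c + ½ * c - ½ * c     ≡⟨ cong (_- ½ * c) (half+half c) ⟩
      c - ½ * c                 ≤⟨ ℚ.+-mono-≤ c≤rN (ℚ.neg-antimono-≤ δ≤½c) ⟩
      a - δ                     ∎

    near-below : Near C δ (a - δ) b
    near-below = near
      (ℚ.<⇒≤ 0<x-δ)
      (ℚ.≤-trans (≤-by {p = a - δ} δ 0≤δ (solve 2 (λ a d → a := a :- d :+ d) refl a δ)) (ℚ.≤-trans rN≤B B≤C))
      (begin
        a - δ       ≤⟨ ℚ.+-monoˡ-≤ (- δ) a≤b+δ ⟩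
        b + δ - δ   ≡⟨ solve 2 (λ b d → b :+ d :- d := b) refl b δ ⟩
        b           ∎)
      (begin
        b                  ≤⟨ b≤a+δ ⟩
        a + δ              ≡⟨ solve 2 (λ a d → a :+ d := a :- d :+ (d :+ d)) refl a δ ⟩
        a - δ + (δ + δ)    ≤⟨ +δδ≤+Cδ (a - δ) ⟩
        a - δ + C * δ      ∎)

    near-above : Near C δ b (a + δ)
    near-above = near
      (ℚ.≤-trans (ℚ.<⇒≤ 0<c) c≤rm)
      (ℚ.≤-trans rm≤B B≤C)
      b≤a+δ
      (begin
        a + δ           ≤⟨ ℚ.+-monoˡ-≤ δ a≤b+δ ⟩
        b + δ + δ       ≡⟨ ℚ.+-assoc b δ δ ⟩
        b + (δ + δ)     ≤⟨ +δδ≤+Cδ b ⟩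
        b + C * δ       ∎)

  approximate : ∀ {n} (x : Vec ℝ n) → (∀ i → 0ℝ R.< lookup x i) → ∀ {e} → 0ℚ < e → Approximation x e
  approximate {n} x 0<x {e} 0<e =
    let c , 0<c , ev₁ = positiveLowerBound x 0<x
        B , 0≤B , ev₂ = upperBound x
        M , nearby    = near-sum (B + (1ℚ + 1ℚ)) (K n)
        -- Three demands on δ: at most δ₀ for the volume error, at most c / 2 to keep `x⁻` positive,
        -- at most 1 for the product estimates.
        δ₀ , 0<δ₀ , M* = ∣∣-factor M 0<e
        δ₁ = (½ * c , half 0<c) ⊓⁺ (1ℚ , 0<1)
        δ , 0<δ = (δ₀ , 0<δ₀) ⊓⁺ δ₁
        δ≤δ₁ = ⊓⁺≤ʳ (δ₀ , 0<δ₀) δ₁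
        δ≤½c = ℚ.≤-trans δ≤δ₁ (⊓⁺≤ˡ (½ * c , half 0<c) (1ℚ , 0<1))
        δ≤1  = ℚ.≤-trans δ≤δ₁ (⊓⁺≤ʳ (½ * c , half 0<c) (1ℚ , 0<1))
    in build c 0<c B 0≤B M nearby δ 0<δ δ≤½c δ≤1
         (M* (ℚ.<⇒≤ 0<δ) (⊓⁺≤ˡ (δ₀ , 0<δ₀) δ₁))
         (eventually-× (eventually-× ev₁ ev₂) (eventually-Close x (half (half 0<δ))))
    where
    build : ∀ c → 0ℚ < c → ∀ B → 0ℚ ≤ B → ∀ M →
      (∀ {δ} → 0ℚ ≤ δ → δ ≤ 1ℚ → ∀ {y y′} → Pointwise (Near (B + (1ℚ + 1ℚ)) δ) y y′ →
        Near M δ (volumeSum y) (volumeSum y′)) →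
      ∀ δ → 0ℚ < δ → δ ≤ ½ * c → δ ≤ 1ℚ → M * δ ≤ e →
      Eventually (λ N → (VecAll.All (λ r → c ≤ seq r N) x × VecAll.All (λ r → seq r N ≤ B) x) ×
                        (∀ m → N ℕ.≤ m → VecAll.All (λ r → Close (½ * (½ * δ)) r N m) x)) →
      Approximation x e
    build c 0<c B 0≤B M nearby δ 0<δ δ≤½c δ≤1 Mδ≤e (N , ev) = record
      { N       = N
      ; κ       = κ
      ; δ       = δ
      ; 0<κ     = half (half 0<δ)
      ; 4κ≡δ    = quarters δ
      ; close   = close
      ; 0<x⁻    = VecAll.map⁺ (VecAll.map proj₁ (facts N ℕ.≤-refl))
      ; 0<x⁺    = VecAll.map⁺ (VecAll.map (λ c≤ → 0<+ (ℚ.<-≤-trans 0<c c≤) 0≤δ) (proj₁ (proj₁ (ev N ℕ.≤-refl))))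
      ; x⁻≤x    = λ m m≥N → pointwise-map {R = _≤_} (VecAll.map (λ f → above (proj₁ (proj₂ f))) (facts m m≥N))
      ; volume⁻ = λ m m≥N → ℚ.≤-trans (Near.within (nearby 0≤δ δ≤1 (below m m≥N)))
                              (ℚ.+-monoʳ-≤ (volumeSum (Vec.map (λ r → seq r N - δ) x)) Mδ≤e)
      ; volume⁺ = λ m m≥N → ℚ.≤-trans (Near.within (nearby 0≤δ δ≤1 (over m m≥N)))
                              (ℚ.+-monoʳ-≤ (volumeSum (x at m)) Mδ≤e)
      }
      where
      0≤δ = ℚ.<⇒≤ 0<δ
      C = B + (1ℚ + 1ℚ)
      κ = ½ * (½ * δ)
      0≤κ = ℚ.<⇒≤ (half (half 0<δ))
      κ≤δ : κ ≤ δ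
      κ≤δ = ≤-by {p = κ} (κ + (κ + κ)) (0≤+ 0≤κ (0≤+ 0≤κ 0≤κ))
              (trans (sym (quarters δ)) (ℚ.+-assoc κ κ (κ + κ)))
      close : ∀ m → N ℕ.≤ m → VecAll.All (λ r → Close κ r N m) x
      close = proj₂ (ev N ℕ.≤-refl)
      Facts : ℕ → ℝ → Set
      Facts m r = 0ℚ < seq r N - δ × Near C δ (seq r N - δ) (seq r m) × Near C δ (seq r m) (seq r N + δ)
      fact : ∀ {m r} → ((c ≤ seq r N × seq r N ≤ B) × (c ≤ seq r m × seq r m ≤ B)) × Close κ r N m → Facts m r
      fact {m} {r} (((c≤rN , rN≤B) , (c≤rm , rm≤B)) , cl) =
        0<x-δ 0≤B 0<c 0≤δ κ≤δ δ≤½c {r} {N} {m} c≤rN rN≤B c≤rm rm≤B cl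
        , near-below 0≤B 0<c 0≤δ κ≤δ δ≤½c {r} {N} {m} c≤rN rN≤B c≤rm rm≤B cl
        , near-above 0≤B 0<c 0≤δ κ≤δ δ≤½c {r} {N} {m} c≤rN rN≤B c≤rm rm≤B cl
      facts : ∀ m → N ℕ.≤ m → VecAll.All (Facts m) x
      facts m m≥N = VecAll.map (λ {r} → fact {m} {r}) (VecAll.zip (VecAll.zip
        (VecAll.zip (proj₁ (ev N ℕ.≤-refl)) , VecAll.zip (proj₁ (ev m m≥N))) , close m m≥N))
      below : ∀ m → N ℕ.≤ m → Pointwise (Near C δ) (Vec.map (λ r → seq r N - δ) x) (x at m)
      below m m≥N = pointwise-map {R = Near C δ} (VecAll.map (λ f → proj₁ (proj₂ f)) (facts m m≥N))
      over : ∀ m → N ℕ.≤ m → Pointwise (Near C δ) (x at m) (Vec.map (λ r → seq r N + δ) x)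
      over m m≥N = pointwise-map {R = Near C δ} (VecAll.map (λ f → proj₂ (proj₂ f)) (facts m m≥N))

  -- Inner and outer boxes for real x

  module _ {n} (x : Vec ℝ n) (ε : ℝ) {e : ℚ} (0<e : 0ℚ < e) (e≤ε : Eventually (λ m → 0ℚ + e ≤ seq ε m))
    (A : Approximation x (½ * e)) where

    open Approximation A
    open ℚ.≤-Reasoning

    private
      V = volumeSumℝ x

      e≤ε′ : ∀ m → proj₁ e≤ε ℕ.≤ m → e ≤ seq ε m
      e≤ε′ m m≥ = ℚ.≤-trans (ℚ.≤-reflexive (sym (ℚ.+-identityˡ e))) (proj₂ e≤ε m m≥)

      large : ∀ m → N ℕ.⊔ proj₁ e≤ε ℕ.≤ m → N ℕ.≤ m × proj₁ e≤ε ℕ.≤ m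
      large m m≥ = ℕ.m⊔n≤o⇒m≤o N _ m≥ , ℕ.m⊔n≤o⇒n≤o N _ m≥

    innerBoxes : Σ (List (Box n)) λ bs →
      AllPairs R.Disjoint bs × All (λ b → ∀ y → y R.∈ᵇ b → Π x y) bs × V R.≤ R.totalVolume bs R.+ ε
    innerBoxes = fromPacking (innerPacking 0<x⁻ ℚ.≤-refl (half 0<e))
      where
      fromPacking : InnerPacking 0ℚ x⁻ (½ * e) → _
      fromPacking (bs , sep , inside , bound) = List.map toBox bs
        , AllPairs.map⁺ (AllPairs.map (λ {b} {c} → Separated⇒Disjoint b c) sep)
        , All.map⁺ (All.map (λ {b} ins → Inside⇒Π x x⁻ b (N , x⁻≤x) ins) inside)
        , seq-≤⇒≤ V (R.totalVolume (List.map toBox bs) R.+ ε) (N ℕ.⊔ proj₁ e≤ε , λ m m≥ → begin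
            seq V m                                   ≡⟨ seq-volumeSumℝ x m ⟩
            volumeSum (x at m)                        ≤⟨ volume⁻ m (proj₁ (large m m≥)) ⟩
            volumeSum x⁻ + ½ * e                      ≡⟨ cong (_+ ½ * e) (volumeSum≡volume x⁻) ⟩
            volume 0ℚ x⁻ + ½ * e                      ≤⟨ ℚ.+-monoˡ-≤ (½ * e) bound ⟩
            totalContent bs + ½ * e + ½ * e           ≡⟨ ℚ.+-assoc (totalContent bs) (½ * e) (½ * e) ⟩
            totalContent bs + (½ * e + ½ * e)         ≡⟨ cong (totalContent bs +_) (half+half e) ⟩
            totalContent bs + e                       ≤⟨ ℚ.+-monoʳ-≤ (totalContent bs) (e≤ε′ m (proj₂ (large m m≥))) ⟩
            totalContent bs + seq ε m                 ≡⟨ cong (_+ seq ε m) (seq-totalVolume bs m) ⟨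
            seq (R.totalVolume (List.map toBox bs)) m + seq ε m ∎)

    -- The rounded point satisfies the constraints of x⁺ exactly, so the box containing it can be
    -- found by deciding rational inequalities.
    roundToRegion : ∀ y → Π x y → ∀ {η} → 0ℚ < η → η ≤ κ → ∃ λ m →
      (∀ m′ → m ℕ.≤ m′ → VecAll.All (λ r → Close η r m m′) y) ×
      InRegion 0ℚ x⁺ (Vec.map (λ r → seq r m + η) y)
    roundToRegion y (0≤y , sums≤) {η} 0<η η≤κ =
      let M , h = eventually-× (eventually-× (eventually-All {P = λ r m → 0ℚ ≤ seq r m + η} y (λ i → 0≤y i η 0<η))
                                             (eventually-Close y 0<η))
                               (eventually-range n (λ i i≥1 i≤n → sums≤ i i≥1 i≤n η 0<η))
          m = M ℕ.⊔ N
          (nonneg , close-y) , sums = h m (ℕ.m≤m⊔n M N)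
      in m , close-y , partialSums⇒InRegion 0ℚ x⁺ _ (VecAll.map⁺ nonneg) (bounds m (ℕ.m≤n⊔m M N) sums)
      where
      bounds : ∀ m → N ℕ.≤ m →
        (∀ i → 1 ℕ.≤ i → i ℕ.≤ n →
          seq (R.sumℝ (List.take i (toList y))) m ≤ seq (R.sumℝ (List.take i (toList x))) m + η) →
        ∀ i → 1 ℕ.≤ i → i ℕ.≤ n → partialSum i (Vec.map (λ r → seq r m + η) y) ≤ 0ℚ + partialSum i x⁺
      bounds m m≥N sums i i≥1 i≤n = begin
        partialSum i (Vec.map (λ r → seq r m + η) y)
          ≡⟨ partialSum-map-+ (λ r → seq r m) η i y i≤n ⟩
        partialSum i (y at m) + steps η i
          ≡⟨ cong (_+ steps η i) (seq-partialSum m i y) ⟨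
        seq (R.sumℝ (List.take i (toList y))) m + steps η i
          ≤⟨ ℚ.+-monoˡ-≤ (steps η i) (sums i i≥1 i≤n) ⟩
        seq (R.sumℝ (List.take i (toList x))) m + η + steps η i
          ≡⟨ cong (λ t → t + η + steps η i) (seq-partialSum m i x) ⟩
        partialSum i (x at m) + η + steps η i
          ≤⟨ ℚ.+-monoˡ-≤ (steps η i) (ℚ.+-monoˡ-≤ η
               (partialSum-mono i (pointwise-map {R = _≤_} (VecAll.map proj₁ (close m m≥N))))) ⟩
        partialSum i (Vec.map (λ r → seq r N + κ) x) + η + steps η i
          ≡⟨ cong (λ t → t + η + steps η i) (partialSum-map-+ (λ r → seq r N) κ i x i≤n) ⟩
        S + steps κ i + η + steps η i
          ≡⟨ solve 4 (λ S a b c → S :+ a :+ b :+ c := S :+ (a :+ b :+ c)) refl S (steps κ i) η (steps η i) ⟩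
        S + (steps κ i + η + steps η i)
          ≤⟨ ℚ.+-monoʳ-≤ S (steps-slack (ℚ.<⇒≤ 0<κ) η≤κ 4κ≡δ i i≥1) ⟩
        S + steps δ i
          ≡⟨ partialSum-map-+ (λ r → seq r N) δ i x i≤n ⟨
        partialSum i x⁺
          ≡⟨ ℚ.+-identityˡ (partialSum i x⁺) ⟨
        0ℚ + partialSum i x⁺ ∎
        where S = partialSum i (x at N)

    outerBoxes : Σ (List (Box n)) λ bs → (∀ y → Π x y → Any (y R.∈ᵇ_) bs) × R.totalVolume bs R.≤ V R.+ ε
    -- Half of e is spent on replacing x by `x⁺`; a quarter goes to the cover and a quarter to
    -- thickening its boxes.
    outerBoxes = fromCover (outerCover 0<x⁺ ℚ.≤-refl (half (half 0<e)))
      where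
      fromCover : OuterCover 0ℚ x⁺ (½ * (½ * e)) → _
      fromCover (bs , covers , bound) =
        let M , nearby = near-totalContent bs
            δ₀ , 0<δ₀ , M* = ∣∣-factor M (half (half 0<e))
            θ , 0<θ = (δ₀ , 0<δ₀) ⊓⁺ (1ℚ , 0<1)
            θ≤1 = ⊓⁺≤ʳ (δ₀ , 0<δ₀) (1ℚ , 0<1)
        in boxes θ 0<θ (ℚ.≤-trans (Near.within (nearby (ℚ.<⇒≤ 0<θ) θ≤1))
                          (ℚ.+-monoʳ-≤ (totalContent bs) (M* (ℚ.<⇒≤ 0<θ) (⊓⁺≤ˡ (δ₀ , 0<δ₀) (1ℚ , 0<1)))))
        where
        module _ (θ : ℚ) (0<θ : 0ℚ < θ)
          (thick : totalContent (List.map (Vec.map (thicken (ℚ.<⇒≤ 0<θ))) bs) ≤ totalContent bs + ½ * (½ * e)) where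

          cs = List.map (Vec.map (thicken (ℚ.<⇒≤ 0<θ))) bs

          covered : ∀ y → Π x y → Any (y R.∈ᵇ_) (List.map toBox cs)
          covered y y∈Π =
            -- η ≤ κ keeps the rounded point in the region of `x⁺`; η ≤ θ / 2 brings y itself into
            -- the thickened box.
            let η , 0<η = (κ , 0<κ) ⊓⁺ (½ * θ , half 0<θ)
                η≤½θ = ⊓⁺≤ʳ (κ , 0<κ) (½ * θ , half 0<θ)
                m , close-y , z∈ = roundToRegion y y∈Π 0<η (⊓⁺≤ˡ (κ , 0<κ) (½ * θ , half 0<θ))
                ηη≤θ = ℚ.≤-trans (ℚ.+-mono-≤ η≤½θ η≤½θ) (ℚ.≤-reflexive (half+half θ))
            in Any.map⁺ (Any.map⁺ (Any.map (λ {b} → InBox⇒∈ᵇ (ℚ.<⇒≤ 0<θ) 0<θ ηη≤θ m y b close-y)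
                                           (covers _ z∈)))

          boxes : Σ (List (Box n)) λ bs → (∀ y → Π x y → Any (y R.∈ᵇ_) bs) × R.totalVolume bs R.≤ V R.+ ε
          boxes = List.map toBox cs , covered
            , seq-≤⇒≤ (R.totalVolume (List.map toBox cs)) (V R.+ ε) (N ℕ.⊔ proj₁ e≤ε , λ m m≥ → begin
                seq (R.totalVolume (List.map toBox cs)) m   ≡⟨ seq-totalVolume cs m ⟩
                totalContent cs                             ≤⟨ thick ⟩
                totalContent bs + e/4                       ≤⟨ ℚ.+-monoˡ-≤ e/4 bound ⟩
                volume 0ℚ x⁺ + e/4 + e/4                    ≡⟨ cong (λ v → v + e/4 + e/4) (volumeSum≡volume x⁺) ⟨
                volumeSum x⁺ + e/4 + e/4                    ≤⟨ ℚ.+-monoˡ-≤ e/4 (ℚ.+-monoˡ-≤ e/4 (volume⁺ m (proj₁ (large m m≥)))) ⟩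
                volumeSum (x at m) + ½ * e + e/4 + e/4      ≡⟨ cong (λ v → volumeSum (x at m) + v + e/4 + e/4) (half+half (½ * e)) ⟨
                volumeSum (x at m) + (e/4 + e/4) + e/4 + e/4
                  ≡⟨ solve 2 (λ v q → v :+ (q :+ q) :+ q :+ q := v :+ (q :+ q :+ (q :+ q))) refl (volumeSum (x at m)) e/4 ⟩
                volumeSum (x at m) + (e/4 + e/4 + (e/4 + e/4)) ≡⟨ cong (volumeSum (x at m) +_) (quarters e) ⟩
                volumeSum (x at m) + e                      ≤⟨ ℚ.+-monoʳ-≤ (volumeSum (x at m)) (e≤ε′ m (proj₂ (large m m≥))) ⟩
                volumeSum (x at m) + seq ε m                ≡⟨ cong (_+ seq ε m) (seq-volumeSumℝ x m) ⟨
                seq V m + seq ε m                           ∎)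
            where e/4 = ½ * (½ * e)

  isVolume : ∀ {n} (x : Vec ℝ n) → (∀ i → 0ℝ R.< lookup x i) → IsVolume (Π x) (volumeSumℝ x)
  isVolume x 0<x ε (e , 0<e , e≤ε) =
    let A = approximate x 0<x (half 0<e)
    in innerBoxes x ε 0<e e≤ε A , outerBoxes x ε 0<e e≤ε A

  -- Arithmetic on ℝ is pointwise, so the rational identity makes the two sequences equal at every
  -- index.
  volumeSumℝ≃multinomialSum : ∀ {n} (x : Vec ℝ n) → volumeSumℝ x R.≃
    R.1/ n ! R.* R.sumℝ (List.map (λ k → R.fromℕ (multinomial n k) R.* R.∏ (Vec.zipWith R._^_ x k)) (K n))
  volumeSumℝ≃multinomialSum {n} x = seq-≡⇒≃
    {volumeSumℝ x}
    {R.1/ n ! R.* R.sumℝ (List.map (λ k → R.fromℕ (multinomial n k) R.* R.∏ (Vec.zipWith R._^_ x k)) (K n))}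
    λ m → trans (seq-volumeSumℝ x m)
      (trans (volumeSum-multinomial (x at m)) (sym (seq-multinomialSum x m)))

open import Defs
open import Data.List.Base as List using ()
open import Data.Nat.Base as ℕ using (ℕ)
open import Data.Product.Base using (_×_; _,_)
open import Data.Vec.Base as Vec using (Vec; lookup)

theorem1 : (n : ℕ) → 1 ℕ.≤ n → (x : Vec ℝ n) → (∀ i → 0ℝ < lookup x i) →
    IsVolume (Π x) (sumℝ (List.map (λ k → ∏ (Vec.zipWith (λ xᵢ kᵢ → xᵢ ^ kᵢ * 1/ kᵢ !) x k)) (K n))) ×
    sumℝ (List.map (λ k → ∏ (Vec.zipWith (λ xᵢ kᵢ → xᵢ ^ kᵢ * 1/ kᵢ !) x k)) (K n)) ≃
    1/ n ! * sumℝ (List.map (λ k → fromℕ (multinomial n k) * ∏ (Vec.zipWith _^_ x k)) (K n))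
theorem1 n _ x 0<x =
  RationalApproximation.isVolume x 0<x , RationalApproximation.volumeSumℝ≃multinomialSum x
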